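{- Suppose that the pPCF judgement $\Gamma\vdash M:t$ holds, for some term $M$ which is not a value. Then $$[\![\Gamma\vdash M:t]\!]=\sum_{M'\text{ term}}\mathrm{Prob}_{M,M'}\cdot[\![\Gamma\vdash M':t]\!].$$
   Context: Syntax of pPCF. Types: $t,u::=\mathrm{nat}\mid t\to u$. Terms: $M,N,\dots::=\underline n\mid x\mid \mathrm{succ}(M)\mid \mathrm{if}(M,P,z\cdot Q)\mid\lambda x^t.M\mid (M)N\mid\mathrm{coin}(\kappa)\mid\mathrm{fix}(M)$, with $n\in\mathbb N$, $x$ a variable, $\kappa\in[0,1]\cap\mathbb Q$ (the variable $z$ is bound in $Q$). Typing: $\Gamma,x:t\vdash x:t$; if $\Gamma,x:t\vdash M:u$ then $\Gamma\vdash\lambda x^t.M:t\to u$; if $\Gamma\vdash M:t\to u$ and $\Gamma\vdash N:t$ then $\Gamma\vdash(M)N:u$; if $\Gamma\vdash M:t\to t$ then $\Gamma\vdash\mathrm{fix}(M):t$; $\Gamma\vdash\underline n:\mathrm{nat}$; if $\Gamma\vdash M:\mathrm{nat}$ then $\Gamma\vdash\mathrm{succ}(M):\mathrm{nat}$; $\Gamma\vdash\mathrm{coin}(\kappa):\mathrm{nat}$; if $\Gamma\vdash M:\mathrm{nat}$, $\Gamma\vdash P:t$ and $\Gamma,z:\mathrm{nat}\vdash Q:t$ then $\Gamma\vdash\mathrm{if}(M,P,z\cdot Q):t$. Reduction $M\xrightarrow{\kappa}M'$ (one step with probability $\kappa$; $\to_d$ means $\xrightarrow{1}$): $\mathrm{coin}(\kappa)\xrightarrow{\kappa}\underline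 0$; $\mathrm{coin}(\kappa)\xrightarrow{1-\kappa}\underline 1$; $\mathrm{fix}(M)\to_d(M)\mathrm{fix}(M)$; $\mathrm{succ}(\underline n)\to_d\underline{n+1}$; $(\lambda x^t.M)N\to_d M[x\mapsto N]$; $\mathrm{if}(\underline 0,P,z\cdot Q)\to_d P$; $\mathrm{if}(\underline{n+1},P,z\cdot Q)\to_d Q[z\mapsto\underline n]$; and if $M\xrightarrow{\kappa}N$ then $\mathrm{succ}(M)\xrightarrow{\kappa}\mathrm{succ}(N)$, $(M)P\xrightarrow{\kappa}(N)P$ and $\mathrm{if}(M,P,z\cdot Q)\xrightarrow{\kappa}\mathrm{if}(N,P,z\cdot Q)$. Reduction preserves typing. A value (normal form, also weak-normal term) is a term admitting no reduction $M\xrightarrow{\kappa}M'$. Matrix: with $\Lambda$ the set of all pPCF terms, $\mathrm{Prob}\in[0,1]^{\Lambda\times\Lambda}$ is given by $\mathrm{Prob}_{M,M'}=\kappa$ if $M\xrightarrow{\kappa}M'$, $\mathrm{Prob}_{M,M'}=1$ if $M=M'$ is weak-normal, and $0$ otherwise. In the sum above, terms $M'$ with $\mathrm{Prob}_{M,M'}=0$ contribute nothing. Semantics. $[\![\mathrm{nat}]\!]=\{\varphi:\mathbb N\to[0,1]\mid\sum_n\varphi(n)\le1\}$ with pointwise order and pointwise (sub)convex sums; elements are written as sequences. $[\![t\to u]\!]$ is the set of Scott-continuous maps $[\![t]\!]\to[\![u]\!]$ with pointwise order and pointwise (sub)convex sums. For $\Gamma=(x_1:t_1,\dots,x_n:t_n)$,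 $[\![\Gamma]\!]=[\![t_1]\!]\times\cdots\times[\![t_n]\!]$, and $[\![\Gamma\vdash M:t]\!]:[\![\Gamma]\!]\to[\![t]\!]$ is the Scott-continuous map defined as follows, where $e_i$ is the sequence with $1$ at $i$ and $0$ elsewhere, and countable sums are suprema of finite partial sums: $[\![x_i]\!](\rho)=\rho_i$; $[\![\underline n]\!](\rho)=e_n$; $[\![\mathrm{coin}(\kappa)]\!](\rho)=\kappa\cdot e_0+(1-\kappa)\cdot e_1$; $[\![\mathrm{succ}(M)]\!](\rho)=(0,u_0,u_1,\dots)$ with $u=[\![M]\!](\rho)$; $[\![\mathrm{if}(M,P,z\cdot Q)]\!](\rho)=v_0u+\sum_{i\ge1}v_iu'_i$ with $v=[\![M]\!](\rho)$, $u=[\![P]\!](\rho)$, $u'_i=[\![\Gamma,z:\mathrm{nat}\vdash Q:t]\!](\rho,e_{i-1})$; $[\![\mathrm{fix}(M)]\!](\rho)=\bigvee_n f^n(\perp)$ with $f=[\![M]\!](\rho)$; $[\![(M)N]\!](\rho)=[\![M]\!](\rho)([\![N]\!](\rho))$; $[\![\lambda x^u.M]\!](\rho)(x)=[\![\Gamma,x:u\vdash M:t]\!](\rho,x)$. Sums of denotations are taken pointwise in $\rho$. -}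

module Defs where

open import Data.Empty using (⊥-elim)
open import Data.Fin using (Fin; zero; suc)
import Data.Fin.Properties as Fin
open import Data.List using (List; []; _∷_; _++_; deduplicate)
open import Data.List.Membership.Propositional using (_∈_)
open import Data.List.Membership.Propositional.Properties
  using (∈-∃++; ∈-++⁺ˡ; ∈-++⁺ʳ; ∈-++⁻; ∈-deduplicate⁺)
open import Data.List.Relation.Unary.All using (All; []; _∷_)
import Data.List.Relation.Unary.All as All
open import Data.List.Relation.Unary.Any using (here; there)
open import Data.List.Relation.Unary.AllPairs using ([]; _∷_)
open import Data.List.Relation.Unary.Unique.Propositional using (Unique)
open import Data.List.Relation.Unary.Unique.DecPropositional.Properties using (deduplicate-!)
open import Data.Nat using (ℕ; zero; suc; _⊔_; _≤′_; ≤′-reflexive; ≤′-step)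
import Data.Nat.Properties as ℕ
open import Data.Product using (∃-syntax; _×_; _,_; proj₁; proj₂; map₂)
open import Data.Rational using (ℚ; 0ℚ; 1ℚ; _+_; _*_; -_; _-_; _≤_; _<_; positive; nonNegative)
import Data.Rational.Properties as ℚ
open import Data.Sum as Sum using (_⊎_; inj₁; inj₂)
open import Data.Unit.Polymorphic using (⊤; tt)
open import Data.Vec using (Vec; []; _∷_; lookup)
open import Relation.Binary using (DecidableEquality)
open import Relation.Binary.PropositionalEquality
  using (_≡_; _≢_; refl; sym; trans; cong; subst)
open import Relation.Nullary using (¬_; Dec; yes; no; contradiction)

-- agda-stdlib has no real numbers.  A real x ∈ [0,∞] is represented by its
-- lower cut { q ∈ ℚ | q < x }.  These lower reals have the directed suprema
-- that Scott continuity needs, which Cauchy or Dedekind reals do not have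
-- constructively; classically all three notions agree on bounded reals.
record [0,∞] : Set₁ where
  no-eta-equality
  infix 4 _∋_
  field
    _∋_  : ℚ → Set
    neg  : ∀ {q} → q < 0ℚ → _∋_ q
    down : ∀ {p q} → p ≤ q → _∋_ q → _∋_ p
    up   : ∀ {q} → _∋_ q → ∃[ r ] q < r × _∋_ r

open [0,∞] public

infix 4 _≼_

record _≼_ (x y : [0,∞]) : Set where
  no-eta-equality
  constructor mk≼
  field at : ∀ {q} → x ∋ q → y ∋ q

open _≼_ public

≼-refl : ∀ {x} → x ≼ x
≼-refl .at p = p

≼-trans : ∀ {x y z} → x ≼ y → y ≼ z → x ≼ z
≼-trans f g .at p = g .at (f .at p)

rat : (r : ℚ) → 0ℚ ≤ r → [0,∞]
rat r 0≤r ._∋_ q       = q < r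
rat r 0≤r .neg q<0     = ℚ.<-≤-trans q<0 0≤r
rat r 0≤r .down p≤q q<r = ℚ.≤-<-trans p≤q q<r
rat r 0≤r .up q<r with ℚ.<-dense q<r
... | s , q<s , s<r = s , q<s , s<r

0≤1 : 0ℚ ≤ 1ℚ
0≤1 = ℚ.<⇒≤ (ℚ.positive⁻¹ 1ℚ)

𝟎 𝟏 : [0,∞]
𝟎 = rat 0ℚ ℚ.≤-refl
𝟏 = rat 1ℚ 0≤1

infixl 6 _⊕_
infixl 7 _⊗_

_⊕_ : [0,∞] → [0,∞] → [0,∞]
(x ⊕ y) ._∋_ q = ∃[ a ] ∃[ b ] x ∋ a × y ∋ b × q ≤ a + b
(x ⊕ y) .neg {q} q<0 with ℚ.<-dense q<0
... | m , q<m , m<0 = m , q - m , neg x m<0 , neg y q-m<0 , ℚ.≤-reflexive (sym eq)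
  where
  q-m<0 : q - m < 0ℚ
  q-m<0 = subst (q - m <_) (ℚ.+-inverseʳ m) (ℚ.+-monoˡ-< (- m) q<m)
  eq : m + (q - m) ≡ q
  eq = trans (ℚ.+-comm m (q - m))
        (trans (ℚ.+-assoc q (- m) m)
          (trans (cong (q +_) (ℚ.+-inverseˡ m)) (ℚ.+-identityʳ q)))
(x ⊕ y) .down p≤q (a , b , xa , yb , q≤) = a , b , xa , yb , ℚ.≤-trans p≤q q≤
(x ⊕ y) .up (a , b , xa , yb , q≤) with up x xa
... | a′ , a<a′ , xa′ =
  a′ + b , ℚ.≤-<-trans q≤ (ℚ.+-monoˡ-< b a<a′) , a′ , b , xa′ , yb , ℚ.≤-refl

-- The negative rationals belong to every cut, so only positive witnesses
-- of the factors carry information about a product; 0 · ∞ = 0.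
_⊗_ : [0,∞] → [0,∞] → [0,∞]
(x ⊗ y) ._∋_ q = q < 0ℚ ⊎
  (∃[ a ] ∃[ b ] (0ℚ < a) × (0ℚ < b) × x ∋ a × y ∋ b × q ≤ a * b)
(x ⊗ y) .neg q<0 = inj₁ q<0
(x ⊗ y) .down p≤q (inj₁ q<0) = inj₁ (ℚ.≤-<-trans p≤q q<0)
(x ⊗ y) .down p≤q (inj₂ (a , b , 0<a , 0<b , xa , yb , q≤)) =
  inj₂ (a , b , 0<a , 0<b , xa , yb , ℚ.≤-trans p≤q q≤)
(x ⊗ y) .up (inj₁ q<0) with ℚ.<-dense q<0
... | m , q<m , m<0 = m , q<m , inj₁ m<0
(x ⊗ y) .up (inj₂ (a , b , 0<a , 0<b , xa , yb , q≤)) with up x xa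
... | a′ , a<a′ , xa′ =
  a′ * b , ℚ.≤-<-trans q≤ (ℚ.*-monoˡ-<-pos b {{positive 0<b}} a<a′) ,
  inj₂ (a′ , b , ℚ.<-trans 0<a a<a′ , 0<b , xa′ , yb , ℚ.≤-refl)

𝟎≼ : ∀ {x} → 𝟎 ≼ x
𝟎≼ {x} .at q<0 = neg x q<0

⊕-mono : ∀ {x x′ y y′} → x ≼ x′ → y ≼ y′ → x ⊕ y ≼ x′ ⊕ y′
⊕-mono f g .at (a , b , xa , yb , q≤) = a , b , f .at xa , g .at yb , q≤

⊕-comm : ∀ {x y} → x ⊕ y ≼ y ⊕ x
⊕-comm .at (a , b , xa , yb , q≤) =
  b , a , yb , xa , ℚ.≤-trans q≤ (ℚ.≤-reflexive (ℚ.+-comm a b))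

⊕-assocˡ : ∀ {x y z} → x ⊕ (y ⊕ z) ≼ (x ⊕ y) ⊕ z
⊕-assocˡ .at (a , b , xa , (c , d , yc , zd , b≤) , q≤) =
  a + c , d , (a , c , xa , yc , ℚ.≤-refl) , zd ,
  ℚ.≤-trans q≤ (ℚ.≤-trans (ℚ.+-monoʳ-≤ a b≤) (ℚ.≤-reflexive (sym (ℚ.+-assoc a c d))))

⊕-assocʳ : ∀ {x y z} → (x ⊕ y) ⊕ z ≼ x ⊕ (y ⊕ z)
⊕-assocʳ .at (a , d , (b , c , xb , yc , a≤) , zd , q≤) =
  b , c + d , xb , (c , d , yc , zd , ℚ.≤-refl) ,
  ℚ.≤-trans q≤ (ℚ.≤-trans (ℚ.+-monoˡ-≤ d a≤) (ℚ.≤-reflexive (ℚ.+-assoc b c d)))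

⊕-identityˡ : ∀ {x} → 𝟎 ⊕ x ≼ x
⊕-identityˡ {x} .at (a , b , a<0 , xb , q≤) =
  down x (ℚ.≤-trans q≤ (ℚ.≤-trans (ℚ.+-monoˡ-≤ b (ℚ.<⇒≤ a<0))
                                   (ℚ.≤-reflexive (ℚ.+-identityˡ b)))) xb

x≼y⊕x : ∀ {x y} → x ≼ y ⊕ x
x≼y⊕x {x} {y} .at {q} xq with up x xq
... | r , q<r , xr = q - r , r , neg y q-r<0 , xr , ℚ.≤-reflexive (sym eq)
  where
  q-r<0 : q - r < 0ℚ
  q-r<0 = subst (q - r <_) (ℚ.+-inverseʳ r) (ℚ.+-monoˡ-< (- r) q<r)
  eq : (q - r) + r ≡ q
  eq = trans (ℚ.+-assoc q (- r) r)
         (trans (cong (q +_) (ℚ.+-inverseˡ r)) (ℚ.+-identityʳ q))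

x≼x⊕y : ∀ {x y} → x ≼ x ⊕ y
x≼x⊕y = ≼-trans x≼y⊕x ⊕-comm

⊕-swap : ∀ {x y z} → x ⊕ (y ⊕ z) ≼ y ⊕ (x ⊕ z)
⊕-swap = ≼-trans ⊕-assocˡ (≼-trans (⊕-mono ⊕-comm ≼-refl) ⊕-assocʳ)

⊕-interchange : ∀ {a b c d} → (a ⊕ b) ⊕ (c ⊕ d) ≼ (a ⊕ c) ⊕ (b ⊕ d)
⊕-interchange =
  ≼-trans ⊕-assocʳ (≼-trans (⊕-mono ≼-refl ⊕-swap) ⊕-assocˡ)

⊗-mono : ∀ {x x′ y y′} → x ≼ x′ → y ≼ y′ → x ⊗ y ≼ x′ ⊗ y′
⊗-mono f g .at (inj₁ q<0) = inj₁ q<0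
⊗-mono f g .at (inj₂ (a , b , 0<a , 0<b , xa , yb , q≤)) =
  inj₂ (a , b , 0<a , 0<b , f .at xa , g .at yb , q≤)

⊗-distribˡ : ∀ {c x y} → c ⊗ x ⊕ c ⊗ y ≼ c ⊗ (x ⊕ y)
⊗-distribˡ {c} {x} {y} .at (r , s , inj₁ r<0 , cys , q≤) =
  ⊗-mono {c} ≼-refl (x≼y⊕x {y} {x}) .at (down (c ⊗ y) (ℚ.≤-trans q≤
    (ℚ.≤-trans (ℚ.+-monoˡ-≤ s (ℚ.<⇒≤ r<0)) (ℚ.≤-reflexive (ℚ.+-identityˡ s)))) cys)
⊗-distribˡ {c} {x} {y} .at (r , s , cxr@(inj₂ _) , inj₁ s<0 , q≤) =
  ⊗-mono {c} ≼-refl (x≼x⊕y {x} {y}) .at (down (c ⊗ x) (ℚ.≤-trans q≤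
    (ℚ.≤-trans (ℚ.+-monoʳ-≤ r (ℚ.<⇒≤ s<0)) (ℚ.≤-reflexive (ℚ.+-identityʳ r)))) cxr)
⊗-distribˡ {c} {x} {y} .at
  {q} (r , s , inj₂ (a , b , 0<a , 0<b , ca , xb , r≤) ,
           inj₂ (a′ , b′ , 0<a′ , 0<b′ , ca′ , yb′ , s≤) , q≤) with ℚ.≤-total a a′
... | inj₁ a≤a′ =
  inj₂ (a′ , b + b′ , 0<a′ , ℚ.+-mono-< 0<b 0<b′ , ca′ , (b , b′ , xb , yb′ , ℚ.≤-refl) ,
    ℚ.≤-trans q≤ (ℚ.≤-trans
      (ℚ.+-mono-≤ (ℚ.≤-trans r≤ (ℚ.*-monoʳ-≤-nonNeg b {{nonNegative (ℚ.<⇒≤ 0<b)}} a≤a′)) s≤)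
      (ℚ.≤-reflexive (sym (ℚ.*-distribˡ-+ a′ b b′)))))
... | inj₂ a′≤a =
  inj₂ (a , b + b′ , 0<a , ℚ.+-mono-< 0<b 0<b′ , ca , (b , b′ , xb , yb′ , ℚ.≤-refl) ,
    ℚ.≤-trans q≤ (ℚ.≤-trans
      (ℚ.+-mono-≤ r≤ (ℚ.≤-trans s≤ (ℚ.*-monoʳ-≤-nonNeg b′ {{nonNegative (ℚ.<⇒≤ 0<b′)}} a′≤a)))
      (ℚ.≤-reflexive (sym (ℚ.*-distribˡ-+ a b b′)))))

x⊗𝟏≼x : ∀ {x} → x ⊗ 𝟏 ≼ x
x⊗𝟏≼x {x} .at (inj₁ q<0) = neg x q<0
x⊗𝟏≼x {x} .at (inj₂ (a , b , 0<a , 0<b , xa , b<1 , q≤)) =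
  down x (ℚ.≤-trans q≤ (ℚ.≤-trans
    (ℚ.*-monoˡ-≤-nonNeg a {{nonNegative (ℚ.<⇒≤ 0<a)}} (ℚ.<⇒≤ b<1))
    (ℚ.≤-reflexive (ℚ.*-identityʳ a)))) xa

sumOver : {I : Set} → (I → [0,∞]) → List I → [0,∞]
sumOver x []      = 𝟎
sumOver x (i ∷ l) = x i ⊕ sumOver x l

-- The supremum of the finite partial sums; a finite set of indices is a
-- duplicate-free list.
∑ : {I : Set} → (I → [0,∞]) → [0,∞]
∑ x ._∋_ q = ∃[ l ] Unique l × sumOver x l ∋ q
∑ x .neg q<0 = [] , [] , q<0
∑ x .down p≤q (l , u , h) = l , u , down (sumOver x l) p≤q h
∑ x .up (l , u , h) with up (sumOver x l) h
... | r , q<r , h′ = r , q<r , l , u , h′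

module _ {I : Set} where

  sumOver-mono : {x y : I → [0,∞]} → (∀ i → x i ≼ y i) → ∀ l → sumOver x l ≼ sumOver y l
  sumOver-mono f []      = ≼-refl
  sumOver-mono f (i ∷ l) = ⊕-mono (f i) (sumOver-mono f l)

  ∑-mono : {x y : I → [0,∞]} → (∀ i → x i ≼ y i) → ∑ x ≼ ∑ y
  ∑-mono f .at (l , u , h) = l , u , sumOver-mono f l .at h

  ∑-least : {x : I → [0,∞]} {y : [0,∞]} → (∀ l → Unique l → sumOver x l ≼ y) → ∑ x ≼ y
  ∑-least f .at (l , u , h) = f l u .at h

  ∑-upper : {x : I → [0,∞]} → ∀ l → Unique l → sumOver x l ≼ ∑ x
  ∑-upper l u .at h = l , u , h

  sumOver-insert : (x : I → [0,∞]) → ∀ i ys zs →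
                   x i ⊕ sumOver x (ys ++ zs) ≼ sumOver x (ys ++ i ∷ zs)
  sumOver-insert x i []       zs = ≼-refl
  sumOver-insert x i (y ∷ ys) zs =
    ≼-trans ⊕-swap (⊕-mono ≼-refl (sumOver-insert x i ys zs))

  sumOver-⊆ : (x : I → [0,∞]) → ∀ {l l′} → Unique l → (∀ {i} → i ∈ l → i ∈ l′) →
              sumOver x l ≼ sumOver x l′
  sumOver-⊆ x [] sub = 𝟎≼
  sumOver-⊆ x {i ∷ l} (i∉l ∷ u) sub with ∈-∃++ (sub (here refl))
  ... | ys , zs , refl =
    ≼-trans (⊕-mono ≼-refl (sumOver-⊆ x u sub′)) (sumOver-insert x i ys zs)
    where
    sub′ : ∀ {j} → j ∈ l → j ∈ ys ++ zs
    sub′ j∈l with ∈-++⁻ ys (sub (there j∈l))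
    ... | inj₁ j∈ys         = ∈-++⁺ˡ j∈ys
    ... | inj₂ (here refl)  = ⊥-elim (All.lookup i∉l j∈l refl)
    ... | inj₂ (there j∈zs) = ∈-++⁺ʳ ys j∈zs

  sumOver-⊕ : (x y : I → [0,∞]) → ∀ l →
              sumOver (λ i → x i ⊕ y i) l ≼ sumOver x l ⊕ sumOver y l
  sumOver-⊕ x y []      = x≼x⊕y
  sumOver-⊕ x y (i ∷ l) = ≼-trans (⊕-mono ≼-refl (sumOver-⊕ x y l)) ⊕-interchange

  sumOver-⊕⁻ : (x y : I → [0,∞]) → ∀ l →
               sumOver x l ⊕ sumOver y l ≼ sumOver (λ i → x i ⊕ y i) l
  sumOver-⊕⁻ x y []      = ⊕-identityˡ
  sumOver-⊕⁻ x y (i ∷ l) = ≼-trans ⊕-interchange (⊕-mono ≼-refl (sumOver-⊕⁻ x y l))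

  ∑-⊕ : {x y : I → [0,∞]} → ∑ (λ i → x i ⊕ y i) ≼ ∑ x ⊕ ∑ y
  ∑-⊕ {x} {y} = ∑-least λ l u →
    ≼-trans (sumOver-⊕ x y l) (⊕-mono (∑-upper l u) (∑-upper l u))

  ∑-⊕⁻ : DecidableEquality I → {x y : I → [0,∞]} → ∑ x ⊕ ∑ y ≼ ∑ (λ i → x i ⊕ y i)
  ∑-⊕⁻ _≟_ {x} {y} .at (a , b , (l , u , xa) , (l′ , u′ , yb) , q≤) =
    L , deduplicate-! _≟_ (l ++ l′) ,
    sumOver-⊕⁻ x y L .at
      ( a , b
      , sumOver-⊆ x u (λ h → ∈-deduplicate⁺ _≟_ (∈-++⁺ˡ h)) .at xa
      , sumOver-⊆ y u′ (λ h → ∈-deduplicate⁺ _≟_ (∈-++⁺ʳ l h)) .at yb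
      , q≤)
    where L = deduplicate _≟_ (l ++ l′)

  ∑-⊗ : {c : [0,∞]} {x : I → [0,∞]} → ∑ (λ i → c ⊗ x i) ≼ c ⊗ ∑ x
  ∑-⊗ {c} {x} = ∑-least λ l u → ≼-trans (go l) (⊗-mono {c} ≼-refl (∑-upper l u))
    where
    go : ∀ l → sumOver (λ i → c ⊗ x i) l ≼ c ⊗ sumOver x l
    go []      = 𝟎≼
    go (i ∷ l) = ≼-trans (⊕-mono ≼-refl (go l)) (⊗-distribˡ {c})

∑-swap : {I J : Set} → DecidableEquality J → (x : I → J → [0,∞]) →
         ∑ (λ i → ∑ (λ j → x i j)) ≼ ∑ (λ j → ∑ (λ i → x i j))
∑-swap {I} _≟_ x = ∑-least λ l u → ≼-trans (go l) (∑-mono λ j → ∑-upper l u)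
  where
  go : ∀ l → sumOver (λ i → ∑ (x i)) l ≼ ∑ (λ j → sumOver (λ i → x i j) l)
  go []      = 𝟎≼
  go (i ∷ l) = ≼-trans (⊕-mono ≼-refl (go l)) (∑-⊕⁻ _≟_)

module _ {I : Set} (_≟_ : DecidableEquality I) where

  pick : [0,∞] → I → I → [0,∞]
  pick x i j with i ≟ j
  ... | yes _ = x
  ... | no  _ = 𝟎

  pick-diag : ∀ x i → x ≼ pick x i i
  pick-diag x i with i ≟ i
  ... | yes _   = ≼-refl
  ... | no  i≢i = ⊥-elim (i≢i refl)

  ∑pick≼ : ∀ x i → ∑ (pick x i) ≼ x
  ∑pick≼ x i = ∑-least go
    where
    vanish : ∀ l → All (i ≢_) l → sumOver (pick x i) l ≼ 𝟎
    vanish []      []       = ≼-refl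
    vanish (j ∷ l) (n ∷ ns) with i ≟ j
    ... | yes i≡j = ⊥-elim (n i≡j)
    ... | no  _   = ≼-trans ⊕-identityˡ (vanish l ns)
    go : ∀ l → Unique l → sumOver (pick x i) l ≼ x
    go []      u       = 𝟎≼
    go (j ∷ l) (n ∷ u) with i ≟ j
    ... | yes refl = ≼-trans (⊕-mono ≼-refl (vanish l n)) (≼-trans ⊕-comm ⊕-identityˡ)
    ... | no  _    = ≼-trans ⊕-identityˡ (go l u)

  e : I → I → [0,∞]
  e = pick 𝟏

  e-diag : ∀ i → 𝟏 ≼ e i i
  e-diag = pick-diag 𝟏

  ∑e≼𝟏 : ∀ i → ∑ (e i) ≼ 𝟏
  ∑e≼𝟏 = ∑pick≼ 𝟏

-- Suprema are taken of families indexed by a small set K.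
record Directed {A : Set₁} (_⊑_ : A → A → Set₁) {K : Set} (f : K → A) : Set₁ where
  constructor directed
  field
    inhabitant : K
    bound      : ∀ j k → ∃[ l ] f j ⊑ f l × f k ⊑ f l

open Directed public

-- Elements are compared by x ⊑ y × y ⊑ x instead of being quotiented.
record DCPO : Set₂ where
  no-eta-equality
  infix 4 _⊑_ _≈_
  field
    Carrier : Set₁
    _⊑_     : Carrier → Carrier → Set₁
    ⊑-refl  : ∀ {x} → x ⊑ x
    ⊑-trans : ∀ {x y z} → x ⊑ y → y ⊑ z → x ⊑ z
    ⨆       : {K : Set} (f : K → Carrier) → Directed _⊑_ f → Carrier
    ⨆-upper : ∀ {K : Set} {f : K → Carrier} (d : Directed _⊑_ f) k → f k ⊑ ⨆ f d
    ⨆-least : ∀ {K : Set} {f : K → Carrier} (d : Directed _⊑_ f) {x} →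
              (∀ k → f k ⊑ x) → ⨆ f d ⊑ x

  _≈_ : Carrier → Carrier → Set₁
  x ≈ y = x ⊑ y × y ⊑ x

  Dir : {K : Set} → (K → Carrier) → Set₁
  Dir = Directed _⊑_

map-directed : {A B : Set₁} {_⊑_ : A → A → Set₁} {_⊑′_ : B → B → Set₁} {K : Set}
               {f : K → A} (g : A → B) → (∀ {x y} → x ⊑ y → g x ⊑′ g y) →
               Directed _⊑_ f → Directed _⊑′_ (λ k → g (f k))
map-directed g mono (directed k₀ b) =
  directed k₀ λ j k → let l , p , q = b j k in l , mono p , mono q

-- The inequality g (⨆ f) ⊒ ⨆ (g ∘ f) follows from monotonicity.
record ScottMap (P Q : DCPO) : Set₁ where
  no-eta-equality
  private
    module P = DCPO P
    module Q = DCPO Q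
  field
    app  : P.Carrier → Q.Carrier
    mono : ∀ {x y} → x P.⊑ y → app x Q.⊑ app y
    cont : ∀ {K : Set} (f : K → P.Carrier) (d : P.Dir f) →
           app (P.⨆ f d) Q.⊑ Q.⨆ (λ k → app (f k)) (map-directed app mono d)

open ScottMap public

-- The bound on the total forces every wt i to lie in [0,1].
record Subprob (I : Set) : Set₁ where
  no-eta-equality
  field
    wt    : I → [0,∞]
    total : ∑ wt ≼ 𝟏

open Subprob public

infix 4 _≤ᵖ_

record _≤ᵖ_ {I : Set} (p q : Subprob I) : Set₁ where
  no-eta-equality
  constructor mk≤ᵖ
  field atᵖ : ∀ i → wt p i ≼ wt q i

open _≤ᵖ_ public

module _ {K : Set} where

  DirectedR : (K → [0,∞]) → Set
  DirectedR x = K × (∀ j k → ∃[ l ] x j ≼ x l × x k ≼ x l)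

  sup : (x : K → [0,∞]) → K → [0,∞]
  sup x k₀ ._∋_ q = ∃[ k ] x k ∋ q
  sup x k₀ .neg q<0 = k₀ , neg (x k₀) q<0
  sup x k₀ .down p≤q (k , h) = k , down (x k) p≤q h
  sup x k₀ .up (k , h) with up (x k) h
  ... | r , q<r , h′ = r , q<r , k , h′

  sup-upper : ∀ {x : K → [0,∞]} {k₀} k → x k ≼ sup x k₀
  sup-upper k .at h = k , h

  sup-least : ∀ {x : K → [0,∞]} {k₀ y} → (∀ k → x k ≼ y) → sup x k₀ ≼ y
  sup-least f .at (k , h) = f k .at h

  sumOver-sup : {I : Set} (x : K → I → [0,∞]) (k₀ : K) →
                (∀ j k → ∃[ l ] (∀ i → x j i ≼ x l i) × (∀ i → x k i ≼ x l i)) →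
                ∀ l → sumOver (λ i → sup (λ k → x k i) k₀) l ≼ sup (λ k → sumOver (x k) l) k₀
  sumOver-sup x k₀ dir []      = sup-upper {x = λ _ → 𝟎} k₀
  sumOver-sup x k₀ dir (i ∷ l) .at (a , b , (j , ha) , hb , q≤)
    with sumOver-sup x k₀ dir l .at hb
  ... | k , hb′ with dir j k
  ... | m , jm , km = m , a , b , jm i .at ha , sumOver-mono km l .at hb′ , q≤

  ∑-sup : {I : Set} (x : K → I → [0,∞]) (k₀ : K) →
          (∀ j k → ∃[ l ] (∀ i → x j i ≼ x l i) × (∀ i → x k i ≼ x l i)) →
          ∑ (λ i → sup (λ k → x k i) k₀) ≼ sup (λ k → ∑ (x k)) k₀
  ∑-sup x k₀ dir .at (l , u , h) with sumOver-sup x k₀ dir l .at h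
  ... | k , h′ = k , l , u , h′

supᵖ : {I K : Set} (p : K → Subprob I) → Directed _≤ᵖ_ p → Subprob I
supᵖ p d .wt i = sup (λ k → wt (p k) i) (inhabitant d)
supᵖ p d .total = ≼-trans
  (∑-sup (λ k → wt (p k)) (inhabitant d)
    λ j k → let l , a , b = bound d j k in l , atᵖ a , atᵖ b)
  (sup-least λ k → total (p k))

𝒱 : Set → DCPO
𝒱 I = record
  { Carrier = Subprob I
  ; _⊑_     = _≤ᵖ_
  ; ⊑-refl  = mk≤ᵖ λ i → ≼-refl
  ; ⊑-trans = λ f g → mk≤ᵖ λ i → ≼-trans (atᵖ f i) (atᵖ g i)
  ; ⨆       = supᵖ
  ; ⨆-upper = λ d k → mk≤ᵖ λ i → sup-upper k
  ; ⨆-least = λ d f → mk≤ᵖ λ i → sup-least λ k → atᵖ (f k) i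
  }

-- wsum p x stands for the subconvex sum ∑ᵢ pᵢ xᵢ.  Decidability of equality
-- on I serves to merge finite sets of indices when proving that such a sum
-- is well defined; its value does not depend on it.
record Domain : Set₂ where
  no-eta-equality
  field
    dcpo : DCPO
  open DCPO dcpo public
  field
    ⊥       : Carrier
    ⊥-least : ∀ {x} → ⊥ ⊑ x
    wsum    : {I : Set} → DecidableEquality I → Subprob I → (I → Carrier) → Carrier
    wsum-mono : ∀ {I : Set} (_≟_ : DecidableEquality I) {p q : Subprob I} {x y : I → Carrier} →
                p ≤ᵖ q → (∀ i → x i ⊑ y i) → wsum _≟_ p x ⊑ wsum _≟_ q y
    wsum-cont : ∀ {I K : Set} (_≟_ : DecidableEquality I)
                (p : K → Subprob I) (dp : Directed _≤ᵖ_ p)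
                (x : K → I → Carrier) (dx : ∀ i → Dir (λ k → x k i)) →
                (∀ j k → ∃[ l ] (p j ≤ᵖ p l × (∀ i → x j i ⊑ x l i))
                              × (p k ≤ᵖ p l × (∀ i → x k i ⊑ x l i))) →
                (dw : Dir (λ k → wsum _≟_ (p k) (x k))) →
                wsum _≟_ (supᵖ p dp) (λ i → ⨆ (λ k → x k i) (dx i)) ⊑
                ⨆ (λ k → wsum _≟_ (p k) (x k)) dw

open Domain using (dcpo)

wsumᵖ : {I J : Set} → DecidableEquality I → Subprob I → (I → Subprob J) → Subprob J
wsumᵖ _≟_ p x .wt j = ∑ λ i → wt p i ⊗ wt (x i) j
wsumᵖ _≟_ p x .total =
  ≼-trans (∑-swap _≟_ _)
  (≼-trans (∑-mono λ i → ≼-trans (∑-⊗ {c = wt p i})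
     (≼-trans (⊗-mono {wt p i} ≼-refl (total (x i))) x⊗𝟏≼x))
   (total p))

𝕟𝕒𝕥 : Domain
𝕟𝕒𝕥 = record
  { dcpo      = 𝒱 ℕ
  ; ⊥         = record { wt = λ _ → 𝟎 ; total = ∑-least zeros }
  ; ⊥-least   = mk≤ᵖ λ i → 𝟎≼
  ; wsum      = wsumᵖ
  ; wsum-mono = λ _ f g → mk≤ᵖ λ n → ∑-mono λ i → ⊗-mono (atᵖ f i) (atᵖ (g i) n)
  ; wsum-cont = λ _ p dp x dx dir dw → mk≤ᵖ λ n →
      ≼-trans (∑-mono λ i → product p dp x dx dir n i)
      (≼-trans
        (∑-sup (λ k i → wt (p k) i ⊗ wt (x k i) n) (inhabitant dp) λ j k →
          let l , (a , b) , (c , d) = dir j k in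
          l , (λ i → ⊗-mono (atᵖ a i) (atᵖ (b i) n)) , (λ i → ⊗-mono (atᵖ c i) (atᵖ (d i) n)))
        (sup-least λ k → sup-upper k))
  }
  where
  zeros : ∀ l → Unique l → sumOver {ℕ} (λ _ → 𝟎) l ≼ 𝟏
  zeros []      _       = 𝟎≼
  zeros (_ ∷ l) (_ ∷ u) = ≼-trans ⊕-identityˡ (zeros l u)
  product : {I K : Set} (p : K → Subprob I) (dp : Directed _≤ᵖ_ p)
            (x : K → I → Subprob ℕ) (dx : ∀ i → Directed _≤ᵖ_ (λ k → x k i)) →
            (∀ j k → ∃[ l ] (p j ≤ᵖ p l × (∀ i → x j i ≤ᵖ x l i))
                          × (p k ≤ᵖ p l × (∀ i → x k i ≤ᵖ x l i))) →
            ∀ n i → wt (supᵖ p dp) i ⊗ wt (supᵖ (λ k → x k i) (dx i)) n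
                  ≼ sup (λ k → wt (p k) i ⊗ wt (x k i) n) (inhabitant dp)
  product p dp x dx dir n i .at (inj₁ q<0) = inhabitant dp , inj₁ q<0
  product p dp x dx dir n i .at (inj₂ (a , b , 0<a , 0<b , (j , pa) , (k , xb) , q≤))
    with dir j k
  ... | l , (pj , _) , (_ , xk) =
    l , inj₂ (a , b , 0<a , 0<b , atᵖ pj i .at pa , atᵖ (xk i) n .at xb , q≤)

infixr 5 _⇒ᴰ_

_⇒ᴰ_ : DCPO → Domain → Domain
P ⇒ᴰ E = record
  { dcpo = record
    { Carrier = ScottMap P E.dcpo
    ; _⊑_     = λ f g → ∀ a → app f a E.⊑ app g a
    ; ⊑-refl  = λ a → E.⊑-refl
    ; ⊑-trans = λ f g a → E.⊑-trans (f a) (g a)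
    ; ⨆       = lub
    ; ⨆-upper = λ d k a → E.⨆-upper (dirAt d a) k
    ; ⨆-least = λ d f a → E.⨆-least (dirAt d a) λ k → f k a
    }
  ; ⊥         = record { app = λ _ → E.⊥ ; mono = λ _ → E.⊑-refl ; cont = λ _ _ → E.⊥-least }
  ; ⊥-least   = λ a → E.⊥-least
  ; wsum      = sum
  ; wsum-mono = λ _≟_ f g a → E.wsum-mono _≟_ f λ i → g i a
  ; wsum-cont = λ _≟_ p dp x dx dir dw a →
      E.wsum-cont _≟_ p dp (λ k i → app (x k i) a) (λ i → dirAt (dx i) a)
        (λ j k → let l , (b , c) , (b′ , c′) = dir j k in
                 l , (b , λ i → c i a) , (b′ , λ i → c′ i a))
        (dirAt dw a)
  }
  where
  module P = DCPO P
  module E = Domain E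
  _⊑ᶠ_ : ScottMap P E.dcpo → ScottMap P E.dcpo → Set₁
  f ⊑ᶠ g = ∀ a → app f a E.⊑ app g a
  dirAt : {K : Set} {f : K → ScottMap P E.dcpo} → Directed _⊑ᶠ_ f →
          ∀ a → E.Dir (λ k → app (f k) a)
  dirAt d a = map-directed {_⊑_ = _⊑ᶠ_} (λ f → app f a) (λ h → h a) d
  lub : {K : Set} (f : K → ScottMap P E.dcpo) → Directed _⊑ᶠ_ f → ScottMap P E.dcpo
  lub f d .app a = E.⨆ (λ k → app (f k) a) (dirAt d a)
  lub f d .mono h = E.⨆-least _ λ k → E.⊑-trans (mono (f k) h) (E.⨆-upper _ k)
  lub f d .cont g dg = E.⨆-least _ λ k → E.⊑-trans (cont (f k) g dg)
    (E.⨆-least _ λ j → E.⊑-trans (E.⨆-upper (dirAt d (g j)) k) (E.⨆-upper _ j))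
  sum : {I : Set} → DecidableEquality I → Subprob I → (I → ScottMap P E.dcpo) → ScottMap P E.dcpo
  sum _≟_ p f .app a = E.wsum _≟_ p λ i → app (f i) a
  sum _≟_ p f .mono h = E.wsum-mono _≟_ (mk≤ᵖ λ i → ≼-refl) λ i → mono (f i) h
  sum _≟_ p f .cont {K} g dg = E.⊑-trans
    (E.wsum-mono _≟_ {q = supᵖ (λ (_ : K) → p) dp}
      (mk≤ᵖ λ i → sup-upper (inhabitant dg)) λ i → cont (f i) g dg)
    (E.wsum-cont _≟_ (λ _ → p) dp (λ k i → app (f i) (g k)) _
      (λ j k → let l , b , c = bound dg j k in
        l , (mk≤ᵖ (λ i → ≼-refl) , λ i → mono (f i) b)
          , (mk≤ᵖ (λ i → ≼-refl) , λ i → mono (f i) c))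
      _)
    where
    dp : Directed _≤ᵖ_ (λ (_ : K) → p)
    dp = directed (inhabitant dg) λ j k → j , mk≤ᵖ (λ i → ≼-refl) , mk≤ᵖ (λ i → ≼-refl)

𝟙 : DCPO
𝟙 = record
  { Carrier = ⊤ ; _⊑_ = λ _ _ → ⊤ ; ⊑-refl = tt ; ⊑-trans = λ _ _ → tt
  ; ⨆ = λ _ _ → tt ; ⨆-upper = λ _ _ → tt ; ⨆-least = λ _ _ → tt }

infixr 6 _×ᴰ_

_×ᴰ_ : DCPO → DCPO → DCPO
P ×ᴰ Q = record
  { Carrier = P.Carrier × Q.Carrier
  ; _⊑_     = _≤_′
  ; ⊑-refl  = P.⊑-refl , Q.⊑-refl
  ; ⊑-trans = λ (a , b) (c , d) → P.⊑-trans a c , Q.⊑-trans b d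
  ; ⨆       = λ f d → P.⨆ (λ k → proj₁ (f k)) (dir₁ d) , Q.⨆ (λ k → proj₂ (f k)) (dir₂ d)
  ; ⨆-upper = λ d k → P.⨆-upper (dir₁ d) k , Q.⨆-upper (dir₂ d) k
  ; ⨆-least = λ d h → P.⨆-least (dir₁ d) (λ k → proj₁ (h k)) , Q.⨆-least (dir₂ d) (λ k → proj₂ (h k))
  }
  where
  module P = DCPO P
  module Q = DCPO Q
  _≤_′ : P.Carrier × Q.Carrier → P.Carrier × Q.Carrier → Set₁
  (a , b) ≤ (c , d) ′ = a P.⊑ c × b Q.⊑ d
  dir₁ : ∀ {K : Set} {f : K → P.Carrier × Q.Carrier} → Directed _≤_′ f → P.Dir (λ k → proj₁ (f k))
  dir₁ = map-directed {_⊑_ = _≤_′} {_⊑′_ = P._⊑_} proj₁ proj₁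
  dir₂ : ∀ {K : Set} {f : K → P.Carrier × Q.Carrier} → Directed _≤_′ f → Q.Dir (λ k → proj₂ (f k))
  dir₂ = map-directed {_⊑_ = _≤_′} {_⊑′_ = Q._⊑_} proj₂ proj₂

const : {P Q : DCPO} → DCPO.Carrier Q → ScottMap P Q
const {Q = Q} c .app _ = c
const {Q = Q} c .mono _ = DCPO.⊑-refl Q
const {Q = Q} c .cont f d = DCPO.⨆-upper Q _ (inhabitant d)

fst : {P Q : DCPO} → ScottMap (P ×ᴰ Q) P
fst .app = proj₁
fst .mono = proj₁
fst {P} .cont f d = DCPO.⊑-refl P

snd : {P Q : DCPO} → ScottMap (P ×ᴰ Q) Q
snd .app = proj₂
snd .mono = proj₂
snd {Q = Q} .cont f d = DCPO.⊑-refl Q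

prepend : {P Q : DCPO} → DCPO.Carrier Q → ScottMap P (Q ×ᴰ P)
prepend c .app ρ = c , ρ
prepend {Q = Q} c .mono h = DCPO.⊑-refl Q , h
prepend {P} {Q} c .cont f d = DCPO.⨆-upper Q _ (inhabitant d) , DCPO.⊑-refl P

infixr 9 _∘ˢ_

_∘ˢ_ : {P Q R : DCPO} → ScottMap Q R → ScottMap P Q → ScottMap P R
(g ∘ˢ f) .app x = app g (app f x)
(g ∘ˢ f) .mono h = mono g (mono f h)
_∘ˢ_ {R = R} g f .cont x d =
  R.⊑-trans (mono g (cont f x d))
  (R.⊑-trans (cont g _ _) (R.⨆-least _ λ k → R.⨆-upper _ k))
  where module R = DCPO R

curry : {P Q : DCPO} {E : Domain} → ScottMap (Q ×ᴰ P) (dcpo E) → ScottMap P (dcpo (Q ⇒ᴰ E))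
curry {P} {Q} {E} f .app ρ .app x = app f (x , ρ)
curry {P} {Q} {E} f .app ρ .mono h = mono f (h , DCPO.⊑-refl P)
curry {P} {Q} {E} f .app ρ .cont x d =
  E.⊑-trans (mono f (Q.⊑-refl , P.⨆-upper dρ (inhabitant d)))
  (E.⊑-trans (cont f (λ k → x k , ρ)
     (directed (inhabitant d) λ j k →
       let l , a , b = bound d j k in l , (a , P.⊑-refl) , (b , P.⊑-refl)))
   (E.⨆-least _ λ k → E.⨆-upper _ k))
  where
  module P = DCPO P
  module Q = DCPO Q
  module E = Domain E
  dρ = map-directed {_⊑_ = Q._⊑_} {_⊑′_ = P._⊑_} (λ _ → ρ) (λ _ → P.⊑-refl) d
curry {P} {Q} f .mono h x = mono f (DCPO.⊑-refl Q , h)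
curry {P} {Q} {E} f .cont ρ d x =
  E.⊑-trans (mono f (Q.⨆-upper dx (inhabitant d) , P.⊑-refl))
  (E.⊑-trans (cont f (λ k → x , ρ k)
     (directed (inhabitant d) λ j k →
       let l , a , b = bound d j k in l , (Q.⊑-refl , a) , (Q.⊑-refl , b)))
   (E.⨆-least _ λ k → E.⨆-upper _ k))
  where
  module P = DCPO P
  module Q = DCPO Q
  module E = Domain E
  dx = map-directed {_⊑_ = P._⊑_} {_⊑′_ = Q._⊑_} (λ _ → x) (λ _ → Q.⊑-refl) d

apply : {P Q : DCPO} {E : Domain} → ScottMap P (dcpo (Q ⇒ᴰ E)) → ScottMap P Q → ScottMap P (dcpo E)
apply f a .app ρ = app (app f ρ) (app a ρ)
apply {E = E} f a .mono {x} {y} h = E.⊑-trans (mono f h (app a x)) (mono (app f y) (mono a h))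
  where module E = Domain E
apply {E = E} f a .cont ρ d =
  E.⊑-trans (cont f ρ d _)
  (E.⨆-least _ λ j → E.⊑-trans (mono (app f (ρ j)) (cont a ρ d))
   (E.⊑-trans (cont (app f (ρ j)) _ _)
    (E.⨆-least _ λ k → let l , b , c = bound d j k in
      E.⊑-trans (mono f b _) (E.⊑-trans (mono (app f (ρ l)) (mono a c)) (E.⨆-upper _ l)))))
  where module E = Domain E

module Fixpoint (E : Domain) where
  private
    module E = Domain E
    module F = Domain (E.dcpo ⇒ᴰ E)

  iterate : F.Carrier → ℕ → E.Carrier
  iterate f zero    = E.⊥
  iterate f (suc n) = app f (iterate f n)

  iterate-step : ∀ f n → iterate f n E.⊑ iterate f (suc n)
  iterate-step f zero    = E.⊥-least
  iterate-step f (suc n) = mono f (iterate-step f n)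

  iterate-mono : ∀ {f g} → f F.⊑ g → ∀ n → iterate f n E.⊑ iterate g n
  iterate-mono h zero            = E.⊑-refl
  iterate-mono {f} {g} h (suc n) = E.⊑-trans (h _) (mono g (iterate-mono h n))

  iterate-≤ : ∀ f {m n} → m ≤′ n → iterate f m E.⊑ iterate f n
  iterate-≤ f (≤′-reflexive refl) = E.⊑-refl
  iterate-≤ f (≤′-step {n} h)     = E.⊑-trans (iterate-≤ f h) (iterate-step f n)

  chain : ∀ f → E.Dir (iterate f)
  chain f = directed 0 λ j k → j ⊔ k ,
    iterate-≤ f (ℕ.≤⇒≤′ (ℕ.m≤m⊔n j k)) , iterate-≤ f (ℕ.≤⇒≤′ (ℕ.m≤n⊔m j k))

  lfp : F.Carrier → E.Carrier
  lfp f = E.⨆ (iterate f) (chain f)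

  lfp-mono : ∀ {f g} → f F.⊑ g → lfp f E.⊑ lfp g
  lfp-mono {f} {g} h = E.⨆-least (chain f) λ n →
    E.⊑-trans (iterate-mono h n) (E.⨆-upper (chain g) n)

  μ : ScottMap F.dcpo E.dcpo
  μ .app = lfp
  μ .mono = lfp-mono
  μ .cont f d = E.⨆-least _ go
    where
    μf : _ → E.Carrier
    μf k = lfp (f k)
    dμ : E.Dir μf
    dμ = map-directed {_⊑_ = F._⊑_} {_⊑′_ = E._⊑_} lfp lfp-mono d
    unfold : ∀ g → app g (lfp g) E.⊑ lfp g
    unfold g = E.⊑-trans (cont g (iterate g) (chain g))
                 (E.⨆-least _ λ n → E.⨆-upper (chain g) (suc n))
    go : ∀ n → iterate (F.⨆ f d) n E.⊑ E.⨆ μf dμ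
    go zero    = E.⊥-least
    go (suc n) = E.⨆-least _ λ j →
      E.⊑-trans (mono (f j) (go n))
      (E.⊑-trans (cont (f j) μf dμ)
       (E.⨆-least _ λ k → let l , a , b = bound d j k in
         E.⊑-trans (a _)
         (E.⊑-trans (mono (f l) (lfp-mono b))
         (E.⊑-trans (unfold (f l)) (E.⨆-upper dμ l)))))

weighted : {P : DCPO} (E : Domain) → ScottMap P (𝒱 ℕ) → (ℕ → ScottMap P (dcpo E)) →
           ScottMap P (dcpo E)
weighted E v x .app ρ = Domain.wsum E ℕ._≟_ (app v ρ) λ i → app (x i) ρ
weighted E v x .mono h = Domain.wsum-mono E ℕ._≟_ (mono v h) λ i → mono (x i) h
weighted {P} E v x .cont ρ d = E.⊑-trans
  (E.wsum-mono ℕ._≟_ (cont v ρ d) λ i → cont (x i) ρ d)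
  (E.wsum-cont ℕ._≟_ (λ k → app v (ρ k)) _ (λ k i → app (x i) (ρ k)) _
    (λ j k → let l , a , b = bound d j k in
      l , (mono v a , λ i → mono (x i) a) , (mono v b , λ i → mono (x i) b)) _)
  where module E = Domain E

shift : (ℕ → [0,∞]) → ℕ → [0,∞]
shift u zero    = 𝟎
shift u (suc n) = u n

∑-shift : ∀ u → ∑ (shift u) ≼ ∑ u
∑-shift u = ∑-least λ l uniq →
  ≼-trans (go l) (∑-upper (preds l) (preds-unique l uniq))
  where
  preds : List ℕ → List ℕ
  preds []          = []
  preds (zero ∷ l)  = preds l
  preds (suc n ∷ l) = n ∷ preds l
  go : ∀ l → sumOver (shift u) l ≼ sumOver u (preds l)
  go []          = ≼-refl
  go (zero ∷ l)  = ≼-trans ⊕-identityˡ (go l)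
  go (suc n ∷ l) = ⊕-mono ≼-refl (go l)
  preds-all : ∀ {n} l → All (suc n ≢_) l → All (n ≢_) (preds l)
  preds-all []          []       = []
  preds-all (zero ∷ l)  (_ ∷ ns) = preds-all l ns
  preds-all (suc m ∷ l) (n ∷ ns) = (λ eq → n (cong suc eq)) ∷ preds-all l ns
  preds-unique : ∀ l → Unique l → Unique (preds l)
  preds-unique []          []       = []
  preds-unique (zero ∷ l)  (_ ∷ us) = preds-unique l us
  preds-unique (suc n ∷ l) (a ∷ us) = preds-all l a ∷ preds-unique l us

succᴰ : ScottMap (𝒱 ℕ) (𝒱 ℕ)
succᴰ .app u = record { wt = shift (wt u) ; total = ≼-trans (∑-shift (wt u)) (total u) }
succᴰ .mono h .atᵖ zero    = ≼-refl
succᴰ .mono h .atᵖ (suc n) = atᵖ h n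
succᴰ .cont f d .atᵖ zero    = 𝟎≼
succᴰ .cont f d .atᵖ (suc n) = ≼-refl

record 𝕀 : Set where
  constructor mk𝕀
  field
    val   : ℚ
    0≤val : 0ℚ ≤ val
    val≤1 : val ≤ 1ℚ

open 𝕀 public

1𝕀 : 𝕀
1𝕀 = mk𝕀 1ℚ 0≤1 ℚ.≤-refl

0𝕀 : 𝕀
0𝕀 = mk𝕀 0ℚ ℚ.≤-refl 0≤1

1-_ : 𝕀 → 𝕀
(1- κ) .val = 1ℚ - val κ
(1- κ) .0≤val = subst (_≤ 1ℚ - val κ) (ℚ.+-inverseʳ (val κ))
  (ℚ.+-monoˡ-≤ (- val κ) (val≤1 κ))
(1- κ) .val≤1 = subst (1ℚ - val κ ≤_) (ℚ.+-identityʳ 1ℚ)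
  (ℚ.+-monoʳ-≤ 1ℚ (ℚ.neg-antimono-≤ (0≤val κ)))

ι : 𝕀 → [0,∞]
ι κ = rat (val κ) (0≤val κ)

infixr 7 _⇒_

data Ty : Set where
  nat : Ty
  _⇒_ : Ty → Ty → Ty

-- Well-scoped de Bruijn terms: Term n is the set of terms, up to
-- α-equivalence, with free variables among x₀, …, xₙ₋₁.
data Term (n : ℕ) : Set where
  lit  : ℕ → Term n
  var  : Fin n → Term n
  succ : Term n → Term n
  if   : Term n → Term n → Term (suc n) → Term n
  lam  : Ty → Term (suc n) → Term n
  _·_  : Term n → Term n → Term n
  coin : 𝕀 → Term n
  fix  : Term n → Term n

infixl 8 _·_

ext : ∀ {m n} → (Fin m → Fin n) → Fin (suc m) → Fin (suc n)
ext r zero    = zero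
ext r (suc i) = suc (r i)

rename : ∀ {m n} → (Fin m → Fin n) → Term m → Term n
rename r (lit k)    = lit k
rename r (var i)    = var (r i)
rename r (succ M)   = succ (rename r M)
rename r (if M P Q) = if (rename r M) (rename r P) (rename (ext r) Q)
rename r (lam t M)  = lam t (rename (ext r) M)
rename r (M · N)    = rename r M · rename r N
rename r (coin κ)   = coin κ
rename r (fix M)    = fix (rename r M)

exts : ∀ {m n} → (Fin m → Term n) → Fin (suc m) → Term (suc n)
exts σ zero    = var zero
exts σ (suc i) = rename suc (σ i)

substitute : ∀ {m n} → (Fin m → Term n) → Term m → Term n
substitute σ (lit k)    = lit k
substitute σ (var i)    = σ i
substitute σ (succ M)   = succ (substitute σ M)
substitute σ (if M P Q) = if (substitute σ M) (substitute σ P) (substitute (exts σ) Q)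
substitute σ (lam t M)  = lam t (substitute (exts σ) M)
substitute σ (M · N)    = substitute σ M · substitute σ N
substitute σ (coin κ)   = coin κ
substitute σ (fix M)    = fix (substitute σ M)

single : ∀ {n} → Term n → Fin (suc n) → Term n
single N zero    = N
single N (suc i) = var i

infix 9 _[_]

_[_] : ∀ {n} → Term (suc n) → Term n → Term n
M [ N ] = substitute (single N) M

infix 3 _⊢_∶_

data _⊢_∶_ {n} (Γ : Vec Ty n) : Term n → Ty → Set where
  var  : ∀ {i t} → lookup Γ i ≡ t → Γ ⊢ var i ∶ t
  lam  : ∀ {t u M} → t ∷ Γ ⊢ M ∶ u → Γ ⊢ lam t M ∶ t ⇒ u
  _·_  : ∀ {t u M N} → Γ ⊢ M ∶ t ⇒ u → Γ ⊢ N ∶ t → Γ ⊢ M · N ∶ u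
  fix  : ∀ {t M} → Γ ⊢ M ∶ t ⇒ t → Γ ⊢ fix M ∶ t
  lit  : ∀ {k} → Γ ⊢ lit k ∶ nat
  succ : ∀ {M} → Γ ⊢ M ∶ nat → Γ ⊢ succ M ∶ nat
  coin : ∀ {κ} → Γ ⊢ coin κ ∶ nat
  if   : ∀ {t M P Q} → Γ ⊢ M ∶ nat → Γ ⊢ P ∶ t → nat ∷ Γ ⊢ Q ∶ t → Γ ⊢ if M P Q ∶ t

infix 3 _⟶⟨_⟩_

data _⟶⟨_⟩_ {n} : Term n → 𝕀 → Term n → Set where
  coin₀   : ∀ {κ} → coin κ ⟶⟨ κ ⟩ lit 0
  coin₁   : ∀ {κ} → coin κ ⟶⟨ 1- κ ⟩ lit 1
  fix     : ∀ {M} → fix M ⟶⟨ 1𝕀 ⟩ M · fix M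
  succ-β  : ∀ {k} → succ (lit k) ⟶⟨ 1𝕀 ⟩ lit (suc k)
  lam-β   : ∀ {t M N} → lam t M · N ⟶⟨ 1𝕀 ⟩ M [ N ]
  if-zero : ∀ {P Q} → if (lit 0) P Q ⟶⟨ 1𝕀 ⟩ P
  if-suc  : ∀ {k P Q} → if (lit (suc k)) P Q ⟶⟨ 1𝕀 ⟩ Q [ lit k ]
  ξ-succ  : ∀ {κ M N} → M ⟶⟨ κ ⟩ N → succ M ⟶⟨ κ ⟩ succ N
  ξ-app   : ∀ {κ M N P} → M ⟶⟨ κ ⟩ N → M · P ⟶⟨ κ ⟩ N · P
  ξ-if    : ∀ {κ M N P Q} → M ⟶⟨ κ ⟩ N → if M P Q ⟶⟨ κ ⟩ if N P Q

Value : ∀ {n} → Term n → Set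
Value {n} M = ¬ (∃[ κ ] ∃[ M′ ] M ⟶⟨ κ ⟩ M′)

_≟𝕀_ : DecidableEquality 𝕀
mk𝕀 p a b ≟𝕀 mk𝕀 q c d with p ℚ.≟ q
... | no  p≢q  = no λ eq → p≢q (cong val eq)
... | yes refl with ℚ.≤-irrelevant a c | ℚ.≤-irrelevant b d
... | refl | refl = yes refl

_≟ᵗ_ : DecidableEquality Ty
nat     ≟ᵗ nat       = yes refl
nat     ≟ᵗ (_ ⇒ _)   = no λ ()
(_ ⇒ _) ≟ᵗ nat       = no λ ()
(t ⇒ u) ≟ᵗ (t′ ⇒ u′) with t ≟ᵗ t′ | u ≟ᵗ u′
... | yes refl | yes refl = yes refl
... | no  ne   | _        = no λ { refl → ne refl }
... | yes _    | no  ne   = no λ { refl → ne refl }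

_≟_ : ∀ {n} → DecidableEquality (Term n)
(lit k) ≟ (lit k′) with k ℕ.≟ k′
... | yes refl = yes refl
... | no ne = no λ { refl → ne refl }
(var i) ≟ (var i′) with i Fin.≟ i′
... | yes refl = yes refl
... | no ne = no λ { refl → ne refl }
(succ M) ≟ (succ M′) with M ≟ M′
... | yes refl = yes refl
... | no ne = no λ { refl → ne refl }
(if M P Q) ≟ (if M′ P′ Q′) with M ≟ M′ | P ≟ P′ | Q ≟ Q′
... | yes refl | yes refl | yes refl = yes refl
... | no ne | _ | _ = no λ { refl → ne refl }
... | yes _ | no ne | _ = no λ { refl → ne refl }
... | yes _ | yes _ | no ne = no λ { refl → ne refl }
(lam t M) ≟ (lam t′ M′) with t ≟ᵗ t′ | M ≟ M′
... | yes refl | yes refl = yes refl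
... | no ne | _ = no λ { refl → ne refl }
... | yes _ | no ne = no λ { refl → ne refl }
(M · N) ≟ (M′ · N′) with M ≟ M′ | N ≟ N′
... | yes refl | yes refl = yes refl
... | no ne | _ = no λ { refl → ne refl }
... | yes _ | no ne = no λ { refl → ne refl }
(coin κ) ≟ (coin κ′) with κ ≟𝕀 κ′
... | yes refl = yes refl
... | no ne = no λ { refl → ne refl }
(fix M) ≟ (fix M′) with M ≟ M′
... | yes refl = yes refl
... | no ne = no λ { refl → ne refl }
(lit _) ≟ (var _) = no λ ()
(lit _) ≟ (succ _) = no λ ()
(lit _) ≟ (if _ _ _) = no λ ()
(lit _) ≟ (lam _ _) = no λ ()
(lit _) ≟ (_ · _) = no λ ()
(lit _) ≟ (coin _) = no λ ()
(lit _) ≟ (fix _) = no λ ()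
(var _) ≟ (lit _) = no λ ()
(var _) ≟ (succ _) = no λ ()
(var _) ≟ (if _ _ _) = no λ ()
(var _) ≟ (lam _ _) = no λ ()
(var _) ≟ (_ · _) = no λ ()
(var _) ≟ (coin _) = no λ ()
(var _) ≟ (fix _) = no λ ()
(succ _) ≟ (lit _) = no λ ()
(succ _) ≟ (var _) = no λ ()
(succ _) ≟ (if _ _ _) = no λ ()
(succ _) ≟ (lam _ _) = no λ ()
(succ _) ≟ (_ · _) = no λ ()
(succ _) ≟ (coin _) = no λ ()
(succ _) ≟ (fix _) = no λ ()
(if _ _ _) ≟ (lit _) = no λ ()
(if _ _ _) ≟ (var _) = no λ ()
(if _ _ _) ≟ (succ _) = no λ ()
(if _ _ _) ≟ (lam _ _) = no λ ()
(if _ _ _) ≟ (_ · _) = no λ ()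
(if _ _ _) ≟ (coin _) = no λ ()
(if _ _ _) ≟ (fix _) = no λ ()
(lam _ _) ≟ (lit _) = no λ ()
(lam _ _) ≟ (var _) = no λ ()
(lam _ _) ≟ (succ _) = no λ ()
(lam _ _) ≟ (if _ _ _) = no λ ()
(lam _ _) ≟ (_ · _) = no λ ()
(lam _ _) ≟ (coin _) = no λ ()
(lam _ _) ≟ (fix _) = no λ ()
(_ · _) ≟ (lit _) = no λ ()
(_ · _) ≟ (var _) = no λ ()
(_ · _) ≟ (succ _) = no λ ()
(_ · _) ≟ (if _ _ _) = no λ ()
(_ · _) ≟ (lam _ _) = no λ ()
(_ · _) ≟ (coin _) = no λ ()
(_ · _) ≟ (fix _) = no λ ()
(coin _) ≟ (lit _) = no λ ()
(coin _) ≟ (var _) = no λ ()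
(coin _) ≟ (succ _) = no λ ()
(coin _) ≟ (if _ _ _) = no λ ()
(coin _) ≟ (lam _ _) = no λ ()
(coin _) ≟ (_ · _) = no λ ()
(coin _) ≟ (fix _) = no λ ()
(fix _) ≟ (lit _) = no λ ()
(fix _) ≟ (var _) = no λ ()
(fix _) ≟ (succ _) = no λ ()
(fix _) ≟ (if _ _ _) = no λ ()
(fix _) ≟ (lam _ _) = no λ ()
(fix _) ≟ (_ · _) = no λ ()
(fix _) ≟ (coin _) = no λ ()

unique-type : ∀ {n} {Γ : Vec Ty n} {M t u} → Γ ⊢ M ∶ t → Γ ⊢ M ∶ u → t ≡ u
unique-type (var p)    (var q)       = trans (sym p) q
unique-type (lam d)    (lam d′)      = cong (_ ⇒_) (unique-type d d′)
unique-type (d · _)    (d′ · _)      with unique-type d d′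
... | refl = refl
unique-type (fix d)    (fix d′)      with unique-type d d′
... | refl = refl
unique-type lit        lit           = refl
unique-type (succ _)   (succ _)      = refl
unique-type coin       coin          = refl
unique-type (if _ d _) (if _ d′ _)   = unique-type d d′

check : ∀ {n} (Γ : Vec Ty n) M t → Dec (Γ ⊢ M ∶ t)
infer : ∀ {n} (Γ : Vec Ty n) M → Dec (∃[ t ] Γ ⊢ M ∶ t)

check Γ M t with infer Γ M
... | no ¬d = no λ d → ¬d (t , d)
... | yes (u , d) with u ≟ᵗ t
... | yes refl = yes d
... | no  u≢t  = no λ d′ → u≢t (unique-type d d′)

infer Γ (lit k) = yes (nat , lit)
infer Γ (var i) = yes (lookup Γ i , var refl)
infer Γ (succ M) with check Γ M nat
... | yes d = yes (nat , succ d)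
... | no ¬d = no λ { (_ , succ d) → ¬d d }
infer Γ (if M P Q) with infer Γ P
... | no ¬p = no λ { (_ , if _ p _) → ¬p (_ , p) }
... | yes (t , p) with check Γ M nat | check (nat ∷ Γ) Q t
... | yes m | yes q = yes (t , if m p q)
... | no ¬m | _     = no λ { (_ , if m _ _) → ¬m m }
... | yes _ | no ¬q = no λ { (_ , if _ p′ q) →
                          ¬q (subst (nat ∷ Γ ⊢ Q ∶_) (unique-type p′ p) q) }
infer Γ (lam t M) with infer (t ∷ Γ) M
... | yes (u , d) = yes (t ⇒ u , lam d)
... | no ¬d       = no λ { (_ , lam d) → ¬d (_ , d) }
infer Γ (M · N) with infer Γ M
... | no ¬m = no λ { (_ , m · _) → ¬m (_ , m) }
... | yes (nat , m) = no λ { (_ , m′ · _) → contradiction (unique-type m m′) λ () }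
... | yes (t ⇒ u , m) with check Γ N t
... | yes n = yes (u , m · n)
... | no ¬n = no λ { (_ , m′ · n) → ¬n (retype (unique-type m′ m) n) }
  where
  retype : ∀ {t′ u′ t u} → t′ ⇒ u′ ≡ t ⇒ u → Γ ⊢ N ∶ t′ → Γ ⊢ N ∶ t
  retype refl n = n
infer Γ (coin κ) = yes (nat , coin)
infer Γ (fix M) with infer Γ M
... | no ¬m = no λ { (_ , fix m) → ¬m (_ , m) }
... | yes (nat , m) = no λ { (_ , fix m′) → contradiction (unique-type m m′) λ () }
... | yes (t ⇒ u , m) with t ≟ᵗ u
... | yes refl = yes (t , fix m)
... | no t≢u   = no λ { (_ , fix m′) → t≢u (same (unique-type m m′)) }
  where
  same : ∀ {v} → t ⇒ u ≡ v ⇒ v → t ≡ u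
  same refl = refl

data Outcome {n} (M : Term n) : Set where
  value : Value M → Outcome M
  step  : ∀ {N} → M ⟶⟨ 1𝕀 ⟩ N →
          (∀ {κ N′} → M ⟶⟨ κ ⟩ N′ → κ ≡ 1𝕀 × N′ ≡ N) → Outcome M
  toss  : ∀ {κ N₀ N₁} → M ⟶⟨ κ ⟩ N₀ → M ⟶⟨ 1- κ ⟩ N₁ →
          (∀ {κ′ N′} → M ⟶⟨ κ′ ⟩ N′ → (κ′ ≡ κ × N′ ≡ N₀) ⊎ (κ′ ≡ 1- κ × N′ ≡ N₁)) →
          Outcome M

lit? : ∀ {n} (M : Term n) → Dec (∃[ k ] M ≡ lit k)
lit? (lit k)    = yes (k , refl)
lit? (var _)    = no λ ()
lit? (succ _)   = no λ ()
lit? (if _ _ _) = no λ ()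
lit? (lam _ _)  = no λ ()
lit? (_ · _)    = no λ ()
lit? (coin _)   = no λ ()
lit? (fix _)    = no λ ()

lam? : ∀ {n} (M : Term n) → Dec (∃[ t ] ∃[ N ] M ≡ lam t N)
lam? (lit _)    = no λ ()
lam? (var _)    = no λ ()
lam? (succ _)   = no λ ()
lam? (if _ _ _) = no λ ()
lam? (lam t N)  = yes (t , N , refl)
lam? (_ · _)    = no λ ()
lam? (coin _)   = no λ ()
lam? (fix _)    = no λ ()

outcome : ∀ {n} (M : Term n) → Outcome M
outcome (lit k) = value λ ()
outcome (var i) = value λ ()
outcome (succ M) with outcome M
... | step r u = step (ξ-succ r) λ
      { succ-β → contradiction r λ () ; (ξ-succ r′) → map₂ (cong succ) (u r′) }
... | toss r s u = toss (ξ-succ r) (ξ-succ s) λ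
      { succ-β → contradiction r λ ()
      ; (ξ-succ r′) → Sum.map (map₂ (cong succ)) (map₂ (cong succ)) (u r′) }
... | value v with lit? M
... | yes (k , refl) = step succ-β λ { succ-β → refl , refl }
... | no ¬lit = value λ
      { (_ , _ , succ-β) → ¬lit (_ , refl) ; (_ , _ , ξ-succ r) → v (_ , _ , r) }
outcome (if M P Q) with outcome M
... | step r u = step (ξ-if r) λ
      { if-zero → contradiction r λ () ; if-suc → contradiction r λ ()
      ; (ξ-if r′) → map₂ (cong λ N → if N P Q) (u r′) }
... | toss r s u = toss (ξ-if r) (ξ-if s) λ
      { if-zero → contradiction r λ () ; if-suc → contradiction r λ ()
      ; (ξ-if r′) → Sum.map (map₂ (cong λ N → if N P Q)) (map₂ (cong λ N → if N P Q)) (u r′) }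
... | value v with lit? M
... | yes (zero , refl)  = step if-zero λ { if-zero → refl , refl }
... | yes (suc k , refl) = step if-suc λ { if-suc → refl , refl }
... | no ¬lit = value λ
      { (_ , _ , if-zero) → ¬lit (_ , refl) ; (_ , _ , if-suc) → ¬lit (_ , refl)
      ; (_ , _ , ξ-if r) → v (_ , _ , r) }
outcome (lam t M) = value λ ()
outcome (M · P) with outcome M
... | step r u = step (ξ-app r) λ
      { lam-β → contradiction r λ () ; (ξ-app r′) → map₂ (cong (_· P)) (u r′) }
... | toss r s u = toss (ξ-app r) (ξ-app s) λ
      { lam-β → contradiction r λ ()
      ; (ξ-app r′) → Sum.map (map₂ (cong (_· P))) (map₂ (cong (_· P))) (u r′) }
... | value v with lam? M
... | yes (t , N , refl) = step lam-β λ { lam-β → refl , refl }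
... | no ¬lam = value λ
      { (_ , _ , lam-β) → ¬lam (_ , _ , refl) ; (_ , _ , ξ-app r) → v (_ , _ , r) }
outcome (coin κ) = toss coin₀ coin₁ λ { coin₀ → inj₁ (refl , refl) ; coin₁ → inj₂ (refl , refl) }
outcome (fix M) = step fix λ { fix → refl , refl }

value? : ∀ {n} (M : Term n) → Dec (Value M)
value? M with outcome M
... | value v    = yes v
... | step r _   = no λ v → v (_ , _ , r)
... | toss r _ _ = no λ v → v (_ , _ , r)

step? : ∀ {n} (M M′ : Term n) → Dec (∃[ κ ] M ⟶⟨ κ ⟩ M′)
step? M M′ with outcome M
... | value v = no λ (κ , r) → v (κ , M′ , r)
... | step {N} r u with M′ ≟ N
...   | yes refl = yes (1𝕀 , r)
...   | no  ne   = no λ (_ , r′) → ne (proj₂ (u r′))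
step? M M′ | toss {κ} {N₀} {N₁} r s u with M′ ≟ N₀ | M′ ≟ N₁
...   | yes refl | _        = yes (κ , r)
...   | no _     | yes refl = yes (1- κ , s)
...   | no ne    | no ne′   = no λ (_ , r′) → Sum.[ (λ p → ne (proj₂ p)) , (λ p → ne′ (proj₂ p)) ]′ (u r′)

Prob : ∀ {n} → Term n → Term n → 𝕀
Prob M M′ with step? M M′
... | yes (κ , _) = κ
... | no _ with M ≟ M′ | value? M
... | yes _ | yes _ = 1𝕀
... | yes _ | no _  = 0𝕀
... | no _  | _     = 0𝕀

Prob-≼ : ∀ {n} (M M′ : Term n) {y} → (∀ {κ} → M ⟶⟨ κ ⟩ M′ → ι κ ≼ y) →
         (Value M → M ≡ M′ → 𝟏 ≼ y) → ι (Prob M M′) ≼ y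
Prob-≼ M M′ red sat with step? M M′
... | yes (κ , r) = red r
... | no _ with M ≟ M′ | value? M
... | yes eq | yes v = ≼-trans (mk≼ λ h → h) (sat v eq)
... | yes _  | no _  = 𝟎≼
... | no _   | _     = 𝟎≼

ι⊕ι≼𝟏 : ∀ κ → ι κ ⊕ ι (1- κ) ≼ 𝟏
ι⊕ι≼𝟏 κ .at (a , b , a<κ , b<1-κ , q≤) =
  ℚ.≤-<-trans q≤ (subst (a + b <_) eq (ℚ.+-mono-< a<κ b<1-κ))
  where
  eq : val κ + (1ℚ - val κ) ≡ 1ℚ
  eq = trans (ℚ.+-comm (val κ) (1ℚ - val κ))
         (trans (ℚ.+-assoc 1ℚ (- val κ) (val κ))
           (trans (cong (1ℚ +_) (ℚ.+-inverseˡ (val κ))) (ℚ.+-identityʳ 1ℚ)))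

∑Prob≼𝟏 : ∀ {n} (M : Term n) → ∑ (λ M′ → ι (Prob M M′)) ≼ 𝟏
∑Prob≼𝟏 {n} M = go (outcome M)
  where
  hit₁ : ∀ {κ N} M′ → κ ≡ 1𝕀 × M′ ≡ N → ι κ ≼ e _≟_ N M′
  hit₁ {N = N} _ (refl , refl) = ≼-trans (mk≼ λ h → h) (e-diag _≟_ N)
  hit₂ : ∀ {κ κ′ N₀ N₁} M′ → (κ′ ≡ κ × M′ ≡ N₀) ⊎ (κ′ ≡ 1- κ × M′ ≡ N₁) →
         ι κ′ ≼ pick _≟_ (ι κ) N₀ M′ ⊕ pick _≟_ (ι (1- κ)) N₁ M′
  hit₂ {κ} {N₀ = N₀} _ (inj₁ (refl , refl)) = ≼-trans (pick-diag _≟_ (ι κ) N₀) x≼x⊕y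
  hit₂ {κ} {N₁ = N₁} _ (inj₂ (refl , refl)) = ≼-trans (pick-diag _≟_ (ι (1- κ)) N₁) x≼y⊕x
  go : Outcome M → ∑ (λ M′ → ι (Prob M M′)) ≼ 𝟏
  go (value v) = ≼-trans
    (∑-mono λ M′ → Prob-≼ M M′ (λ r → contradiction (_ , _ , r) v) λ { _ refl → e-diag _≟_ M })
    (∑e≼𝟏 _≟_ M)
  go (step {N} r u) = ≼-trans
    (∑-mono λ M′ → Prob-≼ M M′ (λ r′ → hit₁ M′ (u r′)) λ v _ → contradiction (_ , _ , r) v)
    (∑e≼𝟏 _≟_ N)
  go (toss {κ} {N₀} {N₁} r s u) = ≼-trans
    (∑-mono λ M′ → Prob-≼ M M′ (λ r′ → hit₂ M′ (u r′)) λ v _ → contradiction (_ , _ , r) v)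
    (≼-trans ∑-⊕ (≼-trans
      (⊕-mono (∑pick≼ _≟_ (ι κ) N₀) (∑pick≼ _≟_ (ι (1- κ)) N₁)) (ι⊕ι≼𝟏 κ)))

Probs : ∀ {n} → Term n → Subprob (Term n)
Probs M .wt M′ = ι (Prob M M′)
Probs M .total = ∑Prob≼𝟏 M

⟦_⟧ᵗ : Ty → Domain
⟦ nat ⟧ᵗ   = 𝕟𝕒𝕥
⟦ t ⇒ u ⟧ᵗ = dcpo ⟦ t ⟧ᵗ ⇒ᴰ ⟦ u ⟧ᵗ

⟦_⟧ᶜ : ∀ {n} → Vec Ty n → DCPO
⟦ [] ⟧ᶜ    = 𝟙
⟦ t ∷ Γ ⟧ᶜ = dcpo ⟦ t ⟧ᵗ ×ᴰ ⟦ Γ ⟧ᶜ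

point : ℕ → Subprob ℕ
point k = record { wt = e ℕ._≟_ k ; total = ∑e≼𝟏 ℕ._≟_ k }

bernoulli : 𝕀 → Subprob ℕ
bernoulli κ .wt m = ι κ ⊗ e ℕ._≟_ 0 m ⊕ ι (1- κ) ⊗ e ℕ._≟_ 1 m
bernoulli κ .total = ≼-trans ∑-⊕ (≼-trans (⊕-mono (part κ 0) (part (1- κ) 1)) (ι⊕ι≼𝟏 κ))
  where
  part : ∀ κ i → ∑ (λ m → ι κ ⊗ e ℕ._≟_ i m) ≼ ι κ
  part κ i = ≼-trans (∑-⊗ {c = ι κ}) (≼-trans (⊗-mono {ι κ} ≼-refl (∑e≼𝟏 ℕ._≟_ i)) x⊗𝟏≼x)

project : ∀ {n} (Γ : Vec Ty n) i → ScottMap ⟦ Γ ⟧ᶜ (dcpo ⟦ lookup Γ i ⟧ᵗ)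
project (t ∷ Γ) zero    = fst {dcpo ⟦ t ⟧ᵗ} {⟦ Γ ⟧ᶜ}
project (t ∷ Γ) (suc i) = _∘ˢ_ {dcpo ⟦ t ⟧ᵗ ×ᴰ ⟦ Γ ⟧ᶜ} {⟦ Γ ⟧ᶜ} {dcpo ⟦ lookup Γ i ⟧ᵗ}
                            (project Γ i) (snd {dcpo ⟦ t ⟧ᵗ} {⟦ Γ ⟧ᶜ})

branch : {P : DCPO} (E : Domain) → ScottMap P (dcpo E) → ScottMap (𝒱 ℕ ×ᴰ P) (dcpo E) →
         ℕ → ScottMap P (dcpo E)
branch     E p q zero    = p
branch {P} E p q (suc i) = _∘ˢ_ {P} {𝒱 ℕ ×ᴰ P} {dcpo E} q (prepend {P} {𝒱 ℕ} (point i))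

⟦_⟧ : ∀ {n} {Γ : Vec Ty n} {M t} → Γ ⊢ M ∶ t → Domain.Carrier (⟦ Γ ⟧ᶜ ⇒ᴰ ⟦ t ⟧ᵗ)
⟦_⟧ {Γ = Γ} (var {i} refl) = project Γ i
⟦_⟧ {Γ = Γ} (lam {t} {u} d) = curry {⟦ Γ ⟧ᶜ} {dcpo ⟦ t ⟧ᵗ} {⟦ u ⟧ᵗ} ⟦ d ⟧
⟦_⟧ {Γ = Γ} (_·_ {t} {u} d d′) = apply {⟦ Γ ⟧ᶜ} {dcpo ⟦ t ⟧ᵗ} {⟦ u ⟧ᵗ} ⟦ d ⟧ ⟦ d′ ⟧
⟦_⟧ {Γ = Γ} (fix {t} d) =
  _∘ˢ_ {⟦ Γ ⟧ᶜ} {dcpo ⟦ t ⇒ t ⟧ᵗ} {dcpo ⟦ t ⟧ᵗ} (Fixpoint.μ ⟦ t ⟧ᵗ) ⟦ d ⟧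
⟦_⟧ {Γ = Γ} (lit {k}) = const {⟦ Γ ⟧ᶜ} {𝒱 ℕ} (point k)
⟦_⟧ {Γ = Γ} (succ d) = _∘ˢ_ {⟦ Γ ⟧ᶜ} {𝒱 ℕ} {𝒱 ℕ} succᴰ ⟦ d ⟧
⟦_⟧ {Γ = Γ} (coin {κ}) = const {⟦ Γ ⟧ᶜ} {𝒱 ℕ} (bernoulli κ)
-- v₀ u + ∑_{i≥1} vᵢ u′ᵢ is written as the single sum ∑_{i≥0} vᵢ wᵢ with
-- w₀ = u and wᵢ = u′ᵢ for i ≥ 1.
⟦_⟧ {Γ = Γ} (if {t} d p q) =
  weighted {⟦ Γ ⟧ᶜ} ⟦ t ⟧ᵗ ⟦ d ⟧ (branch {⟦ Γ ⟧ᶜ} ⟦ t ⟧ᵗ ⟦ p ⟧ ⟦ q ⟧)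

-- ⟦ Γ ⊢ M ∶ t ⟧ as a total function of M.  Ill-typed terms are sent to 0;
-- in the sum over all terms they only occur with coefficient 0, because
-- reduction preserves typing.
⟦_⊢_∶_⟧₀ : ∀ {n} (Γ : Vec Ty n) (M : Term n) (t : Ty) → Domain.Carrier (⟦ Γ ⟧ᶜ ⇒ᴰ ⟦ t ⟧ᵗ)
⟦ Γ ⊢ M ∶ t ⟧₀ with check Γ M t
... | yes d = ⟦ d ⟧
... | no  _ = Domain.⊥ (⟦ Γ ⟧ᶜ ⇒ᴰ ⟦ t ⟧ᵗ)

{-# OPTIONS --safe #-}
module Submission where

-- A term that is not a value either has a single reduct, of probability 1, or
-- has two distinct reducts, of probabilities κ and 1 − κ, coming from the coin
-- in head position.  The semantics is invariant under the rules of the first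
-- kind by the substitution lemma and the fixpoint equation.  For the second
-- kind the identity is immediate at the coin and passes through the evaluation
-- contexts succ, application and if because they are linear in the evaluated
-- subterm; linearity reduces pointwise from higher types to sums in nat.

open import Data.Fin using (Fin; zero; suc)
open import Data.List using ([]; _∷_)
open import Data.List.Relation.Unary.All using ([]; _∷_)
open import Data.List.Relation.Unary.AllPairs using ([]; _∷_)
open import Data.Nat using (ℕ; zero; suc)
import Data.Nat.Properties as ℕ
open import Data.Product using (∃-syntax; _×_; _,_; proj₁; proj₂; map₂; swap)
open import Data.Rational using (0ℚ; 1ℚ; _+_; _*_; 1/_; _≤_; _<_; positive; nonNegative)
import Data.Rational.Properties as ℚ
open import Data.Sum as Sum using (_⊎_; inj₁; inj₂)
open import Data.Vec using (Vec; _∷_; lookup)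
open import Level using (Lift; lift; 0ℓ) renaming (suc to lsuc)
open import Relation.Binary using (DecidableEquality)
open import Relation.Binary.PropositionalEquality
  using (_≡_; _≢_; refl; sym; trans; cong; cong₂; subst; subst₂)
open import Relation.Nullary using (¬_; yes; no; contradiction)
open import Defs

-- Lower reals

infix 4 _≋_

_≋_ : [0,∞] → [0,∞] → Set
x ≋ y = x ≼ y × y ≼ x

≋-refl : ∀ {x} → x ≋ x
≋-refl = ≼-refl , ≼-refl

≋-trans : ∀ {x y z} → x ≋ y → y ≋ z → x ≋ z
≋-trans (f , f′) (g , g′) = ≼-trans f g , ≼-trans g′ f′

⊕-cong : ∀ {x x′ y y′} → x ≋ x′ → y ≋ y′ → x ⊕ y ≋ x′ ⊕ y′
⊕-cong (f , f′) (g , g′) = ⊕-mono f g , ⊕-mono f′ g′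

⊗-cong : ∀ {x x′ y y′} → x ≋ x′ → y ≋ y′ → x ⊗ y ≋ x′ ⊗ y′
⊗-cong (f , f′) (g , g′) = ⊗-mono f g , ⊗-mono f′ g′

∑-cong : ∀ {I : Set} {x y : I → [0,∞]} → (∀ i → x i ≋ y i) → ∑ x ≋ ∑ y
∑-cong f = ∑-mono (λ i → proj₁ (f i)) , ∑-mono (λ i → proj₂ (f i))

⊗-comm : ∀ x y → x ⊗ y ≼ y ⊗ x
⊗-comm x y .at (inj₁ q<0) = inj₁ q<0
⊗-comm x y .at (inj₂ (a , b , 0<a , 0<b , xa , yb , q≤)) =
  inj₂ (b , a , 0<b , 0<a , yb , xa , ℚ.≤-trans q≤ (ℚ.≤-reflexive (ℚ.*-comm a b)))

*-pos : ∀ {a b} → 0ℚ < a → 0ℚ < b → 0ℚ < a * b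
*-pos {a} {b} 0<a 0<b =
  subst (_< a * b) (ℚ.*-zeroˡ b) (ℚ.*-monoˡ-<-pos b {{positive 0<b}} 0<a)

⊗-assocʳ : ∀ x y z → (x ⊗ y) ⊗ z ≼ x ⊗ (y ⊗ z)
⊗-assocʳ x y z .at (inj₁ q<0) = inj₁ q<0
⊗-assocʳ x y z .at (inj₂ (a , b , 0<a , 0<b , inj₁ a<0 , zb , q≤)) =
  contradiction 0<a (ℚ.<-asym a<0)
⊗-assocʳ x y z .at
  (inj₂ (a , b , 0<a , 0<b , inj₂ (c , d , 0<c , 0<d , xc , yd , a≤) , zb , q≤)) =
  inj₂ (c , d * b , 0<c , *-pos 0<d 0<b , xc ,
    inj₂ (d , b , 0<d , 0<b , yd , zb , ℚ.≤-refl) ,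
    ℚ.≤-trans q≤ (ℚ.≤-trans (ℚ.*-monoʳ-≤-nonNeg b {{nonNegative (ℚ.<⇒≤ 0<b)}} a≤)
      (ℚ.≤-reflexive (ℚ.*-assoc c d b))))

⊗-assocˡ : ∀ x y z → x ⊗ (y ⊗ z) ≼ (x ⊗ y) ⊗ z
⊗-assocˡ x y z .at (inj₁ q<0) = inj₁ q<0
⊗-assocˡ x y z .at (inj₂ (a , b , 0<a , 0<b , xa , inj₁ b<0 , q≤)) =
  contradiction 0<b (ℚ.<-asym b<0)
⊗-assocˡ x y z .at
  (inj₂ (a , b , 0<a , 0<b , xa , inj₂ (c , d , 0<c , 0<d , yc , zd , b≤) , q≤)) =
  inj₂ (a * c , d , *-pos 0<a 0<c , 0<d ,
    inj₂ (a , c , 0<a , 0<c , xa , yc , ℚ.≤-refl) , zd ,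
    ℚ.≤-trans q≤ (ℚ.≤-trans (ℚ.*-monoˡ-≤-nonNeg a {{nonNegative (ℚ.<⇒≤ 0<a)}} b≤)
      (ℚ.≤-reflexive (sym (ℚ.*-assoc a c d)))))

⊗-assoc : ∀ x y z → (x ⊗ y) ⊗ z ≋ x ⊗ (y ⊗ z)
⊗-assoc x y z = ⊗-assocʳ x y z , ⊗-assocˡ x y z

-- The product a b is nonnegative but has no positive witness if b = 0, so b
-- is first moved up inside x.
⊗-∋ : ∀ c x {a b} → 0ℚ < a → c ∋ a → x ∋ b → c ⊗ x ∋ a * b
⊗-∋ c x {a} {b} 0<a ca xb with up x xb
... | b′ , b<b′ , xb′ with 0ℚ ℚ.<? b′
... | yes 0<b′ = inj₂ (a , b′ , 0<a , 0<b′ , ca , xb′ ,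
  ℚ.*-monoˡ-≤-nonNeg a {{nonNegative (ℚ.<⇒≤ 0<a)}} (ℚ.<⇒≤ b<b′))
... | no  0≮b′ = inj₁ (subst (a * b <_) (ℚ.*-zeroʳ a)
  (ℚ.*-monoʳ-<-pos a {{positive 0<a}} (ℚ.<-≤-trans b<b′ (ℚ.≮⇒≥ 0≮b′))))

⊗-distribˡ⁻ : ∀ c x y → c ⊗ (x ⊕ y) ≼ c ⊗ x ⊕ c ⊗ y
⊗-distribˡ⁻ c x y .at (inj₁ q<0) = neg (c ⊗ x ⊕ c ⊗ y) q<0
⊗-distribˡ⁻ c x y .at (inj₂ (a , b , 0<a , 0<b , ca , (b₁ , b₂ , xb₁ , yb₂ , b≤) , q≤)) =
  a * b₁ , a * b₂ , ⊗-∋ c x 0<a ca xb₁ , ⊗-∋ c y 0<a ca yb₂ ,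
  ℚ.≤-trans q≤ (ℚ.≤-trans (ℚ.*-monoˡ-≤-nonNeg a {{nonNegative (ℚ.<⇒≤ 0<a)}} b≤)
    (ℚ.≤-reflexive (ℚ.*-distribˡ-+ a b₁ b₂)))

⊗-distribʳ : ∀ c x y → (x ⊕ y) ⊗ c ≋ x ⊗ c ⊕ y ⊗ c
⊗-distribʳ c x y =
  ≼-trans (⊗-comm (x ⊕ y) c)
    (≼-trans (⊗-distribˡ⁻ c x y) (⊕-mono (⊗-comm c x) (⊗-comm c y))) ,
  ≼-trans (⊕-mono (⊗-comm x c) (⊗-comm y c))
    (≼-trans (⊗-distribˡ {c} {x} {y}) (⊗-comm c (x ⊕ y)))

⊗-zeroʳ : ∀ x → x ⊗ 𝟎 ≼ 𝟎
⊗-zeroʳ x .at (inj₁ q<0) = q<0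
⊗-zeroʳ x .at (inj₂ (_ , _ , _ , 0<b , _ , b<0 , _)) = contradiction 0<b (ℚ.<-asym b<0)

⊗-zeroˡ : ∀ x → 𝟎 ⊗ x ≼ 𝟎
⊗-zeroˡ x = ≼-trans (⊗-comm 𝟎 x) (⊗-zeroʳ x)

𝟏⊗x≼x : ∀ x → 𝟏 ⊗ x ≼ x
𝟏⊗x≼x x = ≼-trans (⊗-comm 𝟏 x) x⊗𝟏≼x

-- For 0 ≤ q < r with r in x, any a strictly between q / r and 1 has q ≤ a r.
x≼𝟏⊗x : ∀ x → x ≼ 𝟏 ⊗ x
x≼𝟏⊗x x .at {q} xq with q ℚ.<? 0ℚ
... | yes q<0 = inj₁ q<0
... | no  q≮0 with up x xq
... | r , q<r , xr with ℚ.<-dense q/r<1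
  where
  0<r = ℚ.≤-<-trans (ℚ.≮⇒≥ q≮0) q<r
  instance
    r-pos = positive 0<r
    r≢0 = ℚ.pos⇒nonZero r
    1/r-pos = ℚ.1/pos⇒pos r
  q/r<1 : q * 1/ r < 1ℚ
  q/r<1 = subst (q * 1/ r <_) (ℚ.*-inverseʳ r) (ℚ.*-monoˡ-<-pos (1/ r) q<r)
... | a , q/r<a , a<1 = inj₂ (a , r , 0<a , 0<r , a<1 , xr , q≤ar)
  where
  0<r = ℚ.≤-<-trans (ℚ.≮⇒≥ q≮0) q<r
  instance
    r-pos = positive 0<r
    r-nonNeg = nonNegative (ℚ.<⇒≤ 0<r)
    r≢0 = ℚ.pos⇒nonZero r
    1/r-pos = ℚ.1/pos⇒pos r
    1/r-nonNeg = nonNegative (ℚ.<⇒≤ (ℚ.positive⁻¹ (1/ r)))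
  0<a : 0ℚ < a
  0<a = ℚ.≤-<-trans
    (subst (_≤ q * 1/ r) (ℚ.*-zeroˡ (1/ r)) (ℚ.*-monoʳ-≤-nonNeg (1/ r) (ℚ.≮⇒≥ q≮0))) q/r<a
  q/r*r≡q : q * 1/ r * r ≡ q
  q/r*r≡q = trans (ℚ.*-assoc q (1/ r) r)
    (trans (cong (q *_) (ℚ.*-inverseˡ r)) (ℚ.*-identityʳ q))
  q≤ar : q ≤ a * r
  q≤ar = subst (_≤ a * r) q/r*r≡q (ℚ.*-monoʳ-≤-nonNeg r (ℚ.<⇒≤ q/r<a))

module _ {I : Set} where

  ∑-⊗⁻ : ∀ c (x : I → [0,∞]) → c ⊗ ∑ x ≼ ∑ (λ i → c ⊗ x i)
  ∑-⊗⁻ c x .at (inj₁ q<0) = neg (∑ λ i → c ⊗ x i) q<0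
  ∑-⊗⁻ c x .at (inj₂ (a , b , 0<a , 0<b , ca , (l , u , h) , q≤)) =
    l , u , go l .at (inj₂ (a , b , 0<a , 0<b , ca , h , q≤))
    where
    go : ∀ l → c ⊗ sumOver x l ≼ sumOver (λ i → c ⊗ x i) l
    go []      = ⊗-zeroʳ c
    go (i ∷ l) = ≼-trans (⊗-distribˡ⁻ c (x i) (sumOver x l)) (⊕-mono ≼-refl (go l))

  term≼∑ : ∀ (x : I → [0,∞]) i → x i ≼ ∑ x
  term≼∑ x i = ≼-trans (x≼x⊕y {x i} {𝟎}) (∑-upper {x = x} (i ∷ []) ([] ∷ []))

  two-terms≼∑ : ∀ (x : I → [0,∞]) {i j} → i ≢ j → x i ⊕ x j ≼ ∑ x
  two-terms≼∑ x {i} {j} i≢j =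
    ≼-trans (⊕-mono ≼-refl (x≼x⊕y {x j} {𝟎}))
      (∑-upper {x = x} (i ∷ j ∷ []) ((i≢j ∷ []) ∷ [] ∷ []))

  module _ (_≟ᴵ_ : DecidableEquality I) where

    pick-⊗ : ∀ c (f : I → [0,∞]) i j → pick _≟ᴵ_ c i j ⊗ f j ≼ pick _≟ᴵ_ (c ⊗ f i) i j
    pick-⊗ c f i j with i ≟ᴵ j
    ... | yes refl = ≼-refl
    ... | no  _    = ⊗-zeroˡ (f j)

    ∑pick-⊗ : ∀ c (f : I → [0,∞]) i → ∑ (λ j → pick _≟ᴵ_ c i j ⊗ f j) ≼ c ⊗ f i
    ∑pick-⊗ c f i = ≼-trans (∑-mono (pick-⊗ c f i)) (∑pick≼ _≟ᴵ_ (c ⊗ f i) i)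

    ∑-linear : ∀ c d (x y z : I → [0,∞]) →
      ∑ (λ i → (c ⊗ x i ⊕ d ⊗ y i) ⊗ z i) ≋
      c ⊗ ∑ (λ i → x i ⊗ z i) ⊕ d ⊗ ∑ (λ i → y i ⊗ z i)
    ∑-linear c d x y z = ≋-trans (∑-cong distribute)
      (≋-trans (∑-⊕ , ∑-⊕⁻ _≟ᴵ_) (⊕-cong (scale c x) (scale d y)))
      where
      distribute : ∀ i → (c ⊗ x i ⊕ d ⊗ y i) ⊗ z i ≋ c ⊗ (x i ⊗ z i) ⊕ d ⊗ (y i ⊗ z i)
      distribute i = ≋-trans (⊗-distribʳ (z i) (c ⊗ x i) (d ⊗ y i))
        (⊕-cong (⊗-assoc c (x i) (z i)) (⊗-assoc d (y i) (z i)))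
      scale : ∀ c x → ∑ (λ i → c ⊗ (x i ⊗ z i)) ≋ c ⊗ ∑ (λ i → x i ⊗ z i)
      scale c x = ∑-⊗ {c = c} , ∑-⊗⁻ c (λ i → x i ⊗ z i)

-- Typing

⊢-irrelevant : ∀ {n} {Γ : Vec Ty n} {M t} (d d′ : Γ ⊢ M ∶ t) → d ≡ d′
⊢-irrelevant (var refl) (var refl)  = refl
⊢-irrelevant (lam d)    (lam d′)    = cong lam (⊢-irrelevant d d′)
⊢-irrelevant (d · c)    (d′ · c′)   with unique-type c c′
... | refl = cong₂ _·_ (⊢-irrelevant d d′) (⊢-irrelevant c c′)
⊢-irrelevant (fix d)    (fix d′)    = cong fix (⊢-irrelevant d d′)
⊢-irrelevant lit        lit         = refl
⊢-irrelevant (succ d)   (succ d′)   = cong succ (⊢-irrelevant d d′)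
⊢-irrelevant coin       coin        = refl
⊢-irrelevant (if d p q) (if d′ p′ q′)
  rewrite ⊢-irrelevant d d′ | ⊢-irrelevant p p′ | ⊢-irrelevant q q′ = refl

record Renaming {m n} (Γ : Vec Ty m) (Δ : Vec Ty n) (r : Fin m → Fin n) : Set where
  field lookup-≡ : ∀ i → lookup Δ (r i) ≡ lookup Γ i

open Renaming

record Substitution {m n} (Γ : Vec Ty m) (Δ : Vec Ty n) (s : Fin m → Term n) : Set where
  field image : ∀ i → Δ ⊢ s i ∶ lookup Γ i

open Substitution

ext-⊢ : ∀ {m n} {Γ : Vec Ty m} {Δ : Vec Ty n} {r} t →
        Renaming Γ Δ r → Renaming (t ∷ Γ) (t ∷ Δ) (ext r)
ext-⊢ t ρ .lookup-≡ zero    = refl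
ext-⊢ t ρ .lookup-≡ (suc i) = lookup-≡ ρ i

rename-⊢ : ∀ {m n} {Γ : Vec Ty m} {Δ : Vec Ty n} {r M t} →
           Renaming Γ Δ r → Γ ⊢ M ∶ t → Δ ⊢ rename r M ∶ t
rename-⊢ ρ (var {i} refl) = var (lookup-≡ ρ i)
rename-⊢ ρ (lam d)        = lam (rename-⊢ (ext-⊢ _ ρ) d)
rename-⊢ ρ (d · c)        = rename-⊢ ρ d · rename-⊢ ρ c
rename-⊢ ρ (fix d)        = fix (rename-⊢ ρ d)
rename-⊢ ρ lit            = lit
rename-⊢ ρ (succ d)       = succ (rename-⊢ ρ d)
rename-⊢ ρ coin           = coin
rename-⊢ ρ (if d p q)     = if (rename-⊢ ρ d) (rename-⊢ ρ p) (rename-⊢ (ext-⊢ _ ρ) q)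

suc-⊢ : ∀ {n} {Γ : Vec Ty n} t → Renaming Γ (t ∷ Γ) suc
suc-⊢ t .lookup-≡ i = refl

exts-⊢ : ∀ {m n} {Γ : Vec Ty m} {Δ : Vec Ty n} {s} t →
         Substitution Γ Δ s → Substitution (t ∷ Γ) (t ∷ Δ) (exts s)
exts-⊢ t σ .image zero    = var refl
exts-⊢ t σ .image (suc i) = rename-⊢ (suc-⊢ t) (image σ i)

substitute-⊢ : ∀ {m n} {Γ : Vec Ty m} {Δ : Vec Ty n} {s M t} →
               Substitution Γ Δ s → Γ ⊢ M ∶ t → Δ ⊢ substitute s M ∶ t
substitute-⊢ σ (var {i} refl) = image σ i
substitute-⊢ σ (lam d)        = lam (substitute-⊢ (exts-⊢ _ σ) d)
substitute-⊢ σ (d · c)        = substitute-⊢ σ d · substitute-⊢ σ c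
substitute-⊢ σ (fix d)        = fix (substitute-⊢ σ d)
substitute-⊢ σ lit            = lit
substitute-⊢ σ (succ d)       = succ (substitute-⊢ σ d)
substitute-⊢ σ coin           = coin
substitute-⊢ σ (if d p q)     =
  if (substitute-⊢ σ d) (substitute-⊢ σ p) (substitute-⊢ (exts-⊢ _ σ) q)

single-⊢ : ∀ {n} {Γ : Vec Ty n} {N t} → Γ ⊢ N ∶ t → Substitution (t ∷ Γ) Γ (single N)
single-⊢ c .image zero    = c
single-⊢ c .image (suc i) = var refl

-- The substitution lemma

El : Ty → Set₁
El t = Domain.Carrier ⟦ t ⟧ᵗ

Env : ∀ {n} → Vec Ty n → Set₁
Env Γ = DCPO.Carrier ⟦ Γ ⟧ᶜ

infix 4 _∋_≈_

_∋_≈_ : ∀ t → El t → El t → Set₁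
t ∋ x ≈ y = Domain._≈_ ⟦ t ⟧ᵗ x y

≈-refl : ∀ t {x} → t ∋ x ≈ x
≈-refl t = Domain.⊑-refl ⟦ t ⟧ᵗ , Domain.⊑-refl ⟦ t ⟧ᵗ

≈-sym : ∀ t {x y} → t ∋ x ≈ y → t ∋ y ≈ x
≈-sym t = swap

≈-trans : ∀ t {x y z} → t ∋ x ≈ y → t ∋ y ≈ z → t ∋ x ≈ z
≈-trans t (f , f′) (g , g′) = Domain.⊑-trans ⟦ t ⟧ᵗ f g , Domain.⊑-trans ⟦ t ⟧ᵗ g′ f′

≈-reflexive : ∀ t {x y} → x ≡ y → t ∋ x ≈ y
≈-reflexive t refl = ≈-refl t

≈-ext : ∀ t u {f g : El (t ⇒ u)} → (∀ x → u ∋ app f x ≈ app g x) → t ⇒ u ∋ f ≈ g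
≈-ext t u h = (λ x → proj₁ (h x)) , (λ x → proj₂ (h x))

app-cong : ∀ t u (f : El (t ⇒ u)) {x y} → t ∋ x ≈ y → u ∋ app f x ≈ app f y
app-cong t u f (h , h′) = mono f h , mono f h′

app-cong₂ : ∀ t u {f g : El (t ⇒ u)} {x y} →
            t ⇒ u ∋ f ≈ g → t ∋ x ≈ y → u ∋ app f x ≈ app g y
app-cong₂ t u {f} {g} {x} (h , h′) p = ≈-trans u (h x , h′ x) (app-cong t u g p)

succ-cong : ∀ {v w : Subprob ℕ} → nat ∋ v ≈ w → nat ∋ app succᴰ v ≈ app succᴰ w
succ-cong (h , h′) = mono succᴰ h , mono succᴰ h′

lfp-cong : ∀ t {f g : El (t ⇒ t)} → t ⇒ t ∋ f ≈ g →
           t ∋ Fixpoint.lfp ⟦ t ⟧ᵗ f ≈ Fixpoint.lfp ⟦ t ⟧ᵗ g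
lfp-cong t {f} {g} (h , h′) =
  Fixpoint.lfp-mono ⟦ t ⟧ᵗ {f} {g} h , Fixpoint.lfp-mono ⟦ t ⟧ᵗ {g} {f} h′

wsum-cong : ∀ t {I : Set} (_≟ᴵ_ : DecidableEquality I) {p q : Subprob I} {x y : I → El t} →
            p ≤ᵖ q × q ≤ᵖ p → (∀ i → t ∋ x i ≈ y i) →
            t ∋ Domain.wsum ⟦ t ⟧ᵗ _≟ᴵ_ p x ≈ Domain.wsum ⟦ t ⟧ᵗ _≟ᴵ_ q y
wsum-cong t _≟ᴵ_ (f , f′) h =
  Domain.wsum-mono ⟦ t ⟧ᵗ _≟ᴵ_ f (λ i → proj₁ (h i)) ,
  Domain.wsum-mono ⟦ t ⟧ᵗ _≟ᴵ_ f′ (λ i → proj₂ (h i))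

branches : ∀ {n} {Γ : Vec Ty n} {t P Q} → Γ ⊢ P ∶ t → nat ∷ Γ ⊢ Q ∶ t → Env Γ → ℕ → El t
branches {Γ = Γ} {t} p q γ k = app (branch {⟦ Γ ⟧ᶜ} ⟦ t ⟧ᵗ ⟦ p ⟧ ⟦ q ⟧ k) γ

record Related {m n} {Γ : Vec Ty m} {Δ : Vec Ty n} {s}
               (σ : Substitution Γ Δ s) (γ : Env Γ) (δ : Env Δ) : Set₁ where
  field image-≈ : ∀ i → lookup Γ i ∋ app (project Γ i) γ ≈ app ⟦ image σ i ⟧ δ

open Related

variables : ∀ {m n} {Γ : Vec Ty m} {Δ : Vec Ty n} {r} →
            Renaming Γ Δ r → Substitution Γ Δ (λ i → var (r i))
variables ρ .image i = var (lookup-≡ ρ i)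

⟦var-suc⟧ : ∀ {n} {Γ : Vec Ty n} {i t u} (p : lookup Γ i ≡ t) (x : El u) (γ : Env Γ) →
            app ⟦ var {Γ = u ∷ Γ} {suc i} p ⟧ (x , γ) ≡ app ⟦ var {Γ = Γ} p ⟧ γ
⟦var-suc⟧ refl x γ = refl

ext-related : ∀ {m n} {Γ : Vec Ty m} {Δ : Vec Ty n} {r} t (ρ : Renaming Γ Δ r) {γ δ} (x : El t) →
              Related (variables ρ) γ δ → Related (variables (ext-⊢ t ρ)) (x , γ) (x , δ)
ext-related t ρ x h .image-≈ zero    = ≈-refl t
ext-related {Γ = Γ} {Δ} {r} t ρ {γ} {δ} x h .image-≈ (suc i) =
  ≈-trans (lookup Γ i) (image-≈ h i) (≈-reflexive (lookup Γ i)
    (sym (⟦var-suc⟧ {Γ = Δ} {r i} {u = t} (lookup-≡ ρ i) x δ)))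

⟦rename⟧ : ∀ {m n} {Γ : Vec Ty m} {Δ : Vec Ty n} {r M t} (ρ : Renaming Γ Δ r) (d : Γ ⊢ M ∶ t)
           {γ δ} → Related (variables ρ) γ δ → t ∋ app ⟦ d ⟧ γ ≈ app ⟦ rename-⊢ ρ d ⟧ δ
⟦rename⟧ ρ (var {i} refl) h = image-≈ h i
⟦rename⟧ ρ (lam {t} {u} d) h =
  ≈-ext t u {f = app ⟦ lam d ⟧ _} {app ⟦ lam (rename-⊢ (ext-⊢ t ρ) d) ⟧ _}
    λ x → ⟦rename⟧ (ext-⊢ t ρ) d (ext-related t ρ x h)
⟦rename⟧ ρ (_·_ {t} {u} d c) h =
  app-cong₂ t u {app ⟦ d ⟧ _} {app ⟦ rename-⊢ ρ d ⟧ _} (⟦rename⟧ ρ d h) (⟦rename⟧ ρ c h)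
⟦rename⟧ ρ (fix {t} d) h =
  lfp-cong t {app ⟦ d ⟧ _} {app ⟦ rename-⊢ ρ d ⟧ _} (⟦rename⟧ ρ d h)
⟦rename⟧ ρ lit      h = ≈-refl nat
⟦rename⟧ ρ (succ d) h = succ-cong (⟦rename⟧ ρ d h)
⟦rename⟧ ρ coin     h = ≈-refl nat
⟦rename⟧ {t = t} ρ (if d p q) {γ} {δ} h =
  wsum-cong t ℕ._≟_ {x = branches p q γ} (⟦rename⟧ ρ d h) λ
    { zero    → ⟦rename⟧ ρ p h
    ; (suc k) → ⟦rename⟧ (ext-⊢ nat ρ) q (ext-related nat ρ (point k) h) }

suc-related : ∀ {n} {Γ : Vec Ty n} t (x : El t) (γ : Env Γ) →
              Related (variables (suc-⊢ {Γ = Γ} t)) γ (x , γ)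
suc-related {Γ = Γ} t x γ .image-≈ i = ≈-refl (lookup Γ i)

exts-related : ∀ {m n} {Γ : Vec Ty m} {Δ : Vec Ty n} {s} t (σ : Substitution Γ Δ s) {γ δ}
               (x : El t) → Related σ γ δ → Related (exts-⊢ t σ) (x , γ) (x , δ)
exts-related t σ x h .image-≈ zero = ≈-refl t
exts-related {Γ = Γ} t σ {γ} {δ} x h .image-≈ (suc i) =
  ≈-trans (lookup Γ i) (image-≈ h i) (⟦rename⟧ (suc-⊢ t) (image σ i) (suc-related t x δ))

⟦substitute⟧ : ∀ {m n} {Γ : Vec Ty m} {Δ : Vec Ty n} {s M t}
               (σ : Substitution Γ Δ s) (d : Γ ⊢ M ∶ t) {γ δ} →
               Related σ γ δ → t ∋ app ⟦ d ⟧ γ ≈ app ⟦ substitute-⊢ σ d ⟧ δ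
⟦substitute⟧ σ (var {i} refl) h = image-≈ h i
⟦substitute⟧ σ (lam {t} {u} d) h =
  ≈-ext t u {f = app ⟦ lam d ⟧ _} {app ⟦ lam (substitute-⊢ (exts-⊢ t σ) d) ⟧ _}
    λ x → ⟦substitute⟧ (exts-⊢ t σ) d (exts-related t σ x h)
⟦substitute⟧ σ (_·_ {t} {u} d c) h =
  app-cong₂ t u {app ⟦ d ⟧ _} {app ⟦ substitute-⊢ σ d ⟧ _} (⟦substitute⟧ σ d h) (⟦substitute⟧ σ c h)
⟦substitute⟧ σ (fix {t} d) h =
  lfp-cong t {app ⟦ d ⟧ _} {app ⟦ substitute-⊢ σ d ⟧ _} (⟦substitute⟧ σ d h)
⟦substitute⟧ σ lit      h = ≈-refl nat
⟦substitute⟧ σ (succ d) h = succ-cong (⟦substitute⟧ σ d h)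
⟦substitute⟧ σ coin     h = ≈-refl nat
⟦substitute⟧ {t = t} σ (if d p q) {γ} {δ} h =
  wsum-cong t ℕ._≟_ {x = branches p q γ} (⟦substitute⟧ σ d h) λ
    { zero    → ⟦substitute⟧ σ p h
    ; (suc k) → ⟦substitute⟧ (exts-⊢ nat σ) q (exts-related nat σ (point k) h) }

single-related : ∀ {n} {Γ : Vec Ty n} {N t} (c : Γ ⊢ N ∶ t) (γ : Env Γ) →
                 Related (single-⊢ c) (app ⟦ c ⟧ γ , γ) γ
single-related {t = t} c γ .image-≈ zero    = ≈-refl t
single-related {Γ = Γ} c γ .image-≈ (suc i) = ≈-refl (lookup Γ i)

⟦single⟧ : ∀ {n} {Γ : Vec Ty n} {M N t u} (d : t ∷ Γ ⊢ M ∶ u) (c : Γ ⊢ N ∶ t) (γ : Env Γ) →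
           u ∋ app ⟦ d ⟧ (app ⟦ c ⟧ γ , γ) ≈ app ⟦ substitute-⊢ (single-⊢ c) d ⟧ γ
⟦single⟧ d c γ = ⟦substitute⟧ (single-⊢ c) d (single-related c γ)

-- Sums with one or two terms

wsum-point : ∀ t {I : Set} (_≟ᴵ_ : DecidableEquality I) (p : Subprob I) {i} →
             (∀ j → wt p j ≼ e _≟ᴵ_ i j) → 𝟏 ≼ wt p i → (x : I → El t) →
             t ∋ Domain.wsum ⟦ t ⟧ᵗ _≟ᴵ_ p x ≈ x i
wsum-point nat _≟ᴵ_ p {i} supp mass x =
  mk≤ᵖ (λ n → ≼-trans (∑-mono λ j → ⊗-mono (supp j) ≼-refl)
    (≼-trans (∑pick-⊗ _≟ᴵ_ 𝟏 (λ j → wt (x j) n) i) (𝟏⊗x≼x (wt (x i) n)))) ,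
  mk≤ᵖ (λ n → ≼-trans (x≼𝟏⊗x (wt (x i) n))
    (≼-trans (⊗-mono mass ≼-refl) (term≼∑ (λ j → wt p j ⊗ wt (x j) n) i)))
wsum-point (t ⇒ u) _≟ᴵ_ p {i} supp mass x =
  ≈-ext t u {Domain.wsum ⟦ t ⇒ u ⟧ᵗ _≟ᴵ_ p x} {x i}
    λ a → wsum-point u _≟ᴵ_ p supp mass λ j → app (x j) a

Combination : ∀ t → [0,∞] → [0,∞] → El t → El t → El t → Set₁
Combination nat     c d x y z = Lift (lsuc 0ℓ) (∀ n → wt z n ≋ c ⊗ wt x n ⊕ d ⊗ wt y n)
Combination (t ⇒ u) c d f g h = ∀ a → Combination u c d (app f a) (app g a) (app h a)

wsum-two-points : ∀ t {I : Set} (_≟ᴵ_ : DecidableEquality I) (p : Subprob I) {i j c d} →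
                  i ≢ j → c ≼ wt p i → d ≼ wt p j →
                  (∀ k → wt p k ≼ pick _≟ᴵ_ c i k ⊕ pick _≟ᴵ_ d j k) →
                  (x : I → El t) {z : El t} → Combination t c d (x i) (x j) z →
                  t ∋ z ≈ Domain.wsum ⟦ t ⟧ᵗ _≟ᴵ_ p x
wsum-two-points nat _≟ᴵ_ p {i} {j} {c} {d} i≢j c≼ d≼ supp x (lift h) =
  mk≤ᵖ (λ n → ≼-trans (proj₁ (h n)) (≼-trans (⊕-mono (⊗-mono c≼ ≼-refl) (⊗-mono d≼ ≼-refl))
    (two-terms≼∑ (λ k → wt p k ⊗ wt (x k) n) i≢j))) ,
  mk≤ᵖ (λ n → ≼-trans (≼-trans (∑-mono (split n)) ∑-⊕)
    (≼-trans (⊕-mono (∑pick-⊗ _≟ᴵ_ c (λ k → wt (x k) n) i) (∑pick-⊗ _≟ᴵ_ d (λ k → wt (x k) n) j))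
      (proj₂ (h n))))
  where
  split : ∀ n k → wt p k ⊗ wt (x k) n ≼
                  pick _≟ᴵ_ c i k ⊗ wt (x k) n ⊕ pick _≟ᴵ_ d j k ⊗ wt (x k) n
  split n k = ≼-trans (⊗-mono (supp k) ≼-refl)
    (proj₁ (⊗-distribʳ (wt (x k) n) (pick _≟ᴵ_ c i k) (pick _≟ᴵ_ d j k)))
wsum-two-points (t ⇒ u) _≟ᴵ_ p i≢j c≼ d≼ supp x {z} h =
  ≈-ext t u {z} {Domain.wsum ⟦ t ⇒ u ⟧ᵗ _≟ᴵ_ p x}
    λ a → wsum-two-points u _≟ᴵ_ p i≢j c≼ d≼ supp (λ k → app (x k) a) (h a)

wsum-linear : ∀ t {c d} {v w u : Subprob ℕ} → Combination nat c d v w u → (x : ℕ → El t) →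
              Combination t c d (Domain.wsum ⟦ t ⟧ᵗ ℕ._≟_ v x)
                (Domain.wsum ⟦ t ⟧ᵗ ℕ._≟_ w x) (Domain.wsum ⟦ t ⟧ᵗ ℕ._≟_ u x)
wsum-linear nat {c} {d} {v} {w} (lift h) x = lift λ n →
  ≋-trans (∑-cong λ i → ⊗-cong (h i) ≋-refl)
    (∑-linear ℕ._≟_ c d (wt v) (wt w) λ i → wt (x i) n)
wsum-linear (t ⇒ u) h x a = wsum-linear u h λ i → app (x i) a

succ-linear : ∀ {c d} {v w u : Subprob ℕ} → Combination nat c d v w u →
              Combination nat c d (app succᴰ v) (app succᴰ w) (app succᴰ u)
succ-linear {c} {d} (lift h) = lift λ
  { zero    → 𝟎≼ , ≼-trans (⊕-mono (⊗-zeroʳ c) (⊗-zeroʳ d)) ⊕-identityˡ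
  ; (suc n) → h n }

-- Reduction

preservation : ∀ {n} {Γ : Vec Ty n} {M N κ t} → M ⟶⟨ κ ⟩ N → Γ ⊢ M ∶ t → Γ ⊢ N ∶ t
preservation coin₀      coin         = lit
preservation coin₁      coin         = lit
preservation fix        (fix d)      = d · fix d
preservation succ-β     (succ lit)   = lit
preservation lam-β      (lam d · c)  = substitute-⊢ (single-⊢ c) d
preservation if-zero    (if lit p q) = p
preservation if-suc     (if lit p q) = substitute-⊢ (single-⊢ lit) q
preservation (ξ-succ r) (succ d)     = succ (preservation r d)
preservation (ξ-app r)  (d · c)      = preservation r d · c
preservation (ξ-if r)   (if d p q)   = if (preservation r d) p q

infix 3 _⟶ᵈ_ _⟶ᵗ⟨_⟩_∣_

data _⟶ᵈ_ {n} : Term n → Term n → Set where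
  fix     : ∀ {M} → fix M ⟶ᵈ M · fix M
  succ-β  : ∀ {k} → succ (lit k) ⟶ᵈ lit (suc k)
  lam-β   : ∀ {t M N} → lam t M · N ⟶ᵈ M [ N ]
  if-zero : ∀ {P Q} → if (lit 0) P Q ⟶ᵈ P
  if-suc  : ∀ {k P Q} → if (lit (suc k)) P Q ⟶ᵈ Q [ lit k ]
  ξ-succ  : ∀ {M N} → M ⟶ᵈ N → succ M ⟶ᵈ succ N
  ξ-app   : ∀ {M N P} → M ⟶ᵈ N → M · P ⟶ᵈ N · P
  ξ-if    : ∀ {M N P Q} → M ⟶ᵈ N → if M P Q ⟶ᵈ if N P Q

data _⟶ᵗ⟨_⟩_∣_ {n} : Term n → 𝕀 → Term n → Term n → Set where
  coin    : ∀ {κ} → coin κ ⟶ᵗ⟨ κ ⟩ lit 0 ∣ lit 1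
  ξ-succ  : ∀ {κ M N₀ N₁} → M ⟶ᵗ⟨ κ ⟩ N₀ ∣ N₁ → succ M ⟶ᵗ⟨ κ ⟩ succ N₀ ∣ succ N₁
  ξ-app   : ∀ {κ M N₀ N₁ P} → M ⟶ᵗ⟨ κ ⟩ N₀ ∣ N₁ → M · P ⟶ᵗ⟨ κ ⟩ N₀ · P ∣ N₁ · P
  ξ-if    : ∀ {κ M N₀ N₁ P Q} → M ⟶ᵗ⟨ κ ⟩ N₀ ∣ N₁ → if M P Q ⟶ᵗ⟨ κ ⟩ if N₀ P Q ∣ if N₁ P Q

module _ {n : ℕ} where

  classify : ∀ {M N : Term n} {κ} → M ⟶⟨ κ ⟩ N →
             (∃[ N′ ] M ⟶ᵈ N′) ⊎ (∃[ κ′ ] ∃[ N₀ ] ∃[ N₁ ] M ⟶ᵗ⟨ κ′ ⟩ N₀ ∣ N₁)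
  classify coin₀   = inj₂ (_ , _ , _ , coin)
  classify coin₁   = inj₂ (_ , _ , _ , coin)
  classify fix     = inj₁ (_ , fix)
  classify succ-β  = inj₁ (_ , succ-β)
  classify lam-β   = inj₁ (_ , lam-β)
  classify if-zero = inj₁ (_ , if-zero)
  classify if-suc  = inj₁ (_ , if-suc)
  classify (ξ-succ r) =
    Sum.map (λ (_ , s) → _ , ξ-succ s) (λ (_ , _ , _ , s) → _ , _ , _ , ξ-succ s) (classify r)
  classify (ξ-app r) =
    Sum.map (λ (_ , s) → _ , ξ-app s) (λ (_ , _ , _ , s) → _ , _ , _ , ξ-app s) (classify r)
  classify (ξ-if r) =
    Sum.map (λ (_ , s) → _ , ξ-if s) (λ (_ , _ , _ , s) → _ , _ , _ , ξ-if s) (classify r)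

  ⟶ᵈ⇒⟶ : ∀ {M N : Term n} → M ⟶ᵈ N → M ⟶⟨ 1𝕀 ⟩ N
  ⟶ᵈ⇒⟶ fix        = fix
  ⟶ᵈ⇒⟶ succ-β     = succ-β
  ⟶ᵈ⇒⟶ lam-β      = lam-β
  ⟶ᵈ⇒⟶ if-zero    = if-zero
  ⟶ᵈ⇒⟶ if-suc     = if-suc
  ⟶ᵈ⇒⟶ (ξ-succ r) = ξ-succ (⟶ᵈ⇒⟶ r)
  ⟶ᵈ⇒⟶ (ξ-app r)  = ξ-app (⟶ᵈ⇒⟶ r)
  ⟶ᵈ⇒⟶ (ξ-if r)   = ξ-if (⟶ᵈ⇒⟶ r)

  ⟶ᵈ-unique : ∀ {M N N′ : Term n} {κ} → M ⟶ᵈ N → M ⟶⟨ κ ⟩ N′ → κ ≡ 1𝕀 × N′ ≡ N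
  ⟶ᵈ-unique fix         fix         = refl , refl
  ⟶ᵈ-unique succ-β      succ-β      = refl , refl
  ⟶ᵈ-unique lam-β       lam-β       = refl , refl
  ⟶ᵈ-unique if-zero     if-zero     = refl , refl
  ⟶ᵈ-unique if-suc      if-suc      = refl , refl
  ⟶ᵈ-unique (ξ-succ r)  (ξ-succ r′) = map₂ (cong succ) (⟶ᵈ-unique r r′)
  ⟶ᵈ-unique (ξ-app r)   (ξ-app r′)  = map₂ (cong (_· _)) (⟶ᵈ-unique r r′)
  ⟶ᵈ-unique (ξ-if r)    (ξ-if r′)   = map₂ (cong λ N → if N _ _) (⟶ᵈ-unique r r′)
  ⟶ᵈ-unique succ-β      (ξ-succ ())
  ⟶ᵈ-unique lam-β       (ξ-app ())
  ⟶ᵈ-unique if-zero     (ξ-if ())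
  ⟶ᵈ-unique if-suc      (ξ-if ())
  ⟶ᵈ-unique (ξ-succ ()) succ-β
  ⟶ᵈ-unique (ξ-app ())  lam-β
  ⟶ᵈ-unique (ξ-if ())   if-zero
  ⟶ᵈ-unique (ξ-if ())   if-suc

  ⟶ᵗ⇒⟶₀ : ∀ {M N₀ N₁ : Term n} {κ} → M ⟶ᵗ⟨ κ ⟩ N₀ ∣ N₁ → M ⟶⟨ κ ⟩ N₀
  ⟶ᵗ⇒⟶₀ coin       = coin₀
  ⟶ᵗ⇒⟶₀ (ξ-succ r) = ξ-succ (⟶ᵗ⇒⟶₀ r)
  ⟶ᵗ⇒⟶₀ (ξ-app r)  = ξ-app (⟶ᵗ⇒⟶₀ r)
  ⟶ᵗ⇒⟶₀ (ξ-if r)   = ξ-if (⟶ᵗ⇒⟶₀ r)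

  ⟶ᵗ⇒⟶₁ : ∀ {M N₀ N₁ : Term n} {κ} → M ⟶ᵗ⟨ κ ⟩ N₀ ∣ N₁ → M ⟶⟨ 1- κ ⟩ N₁
  ⟶ᵗ⇒⟶₁ coin       = coin₁
  ⟶ᵗ⇒⟶₁ (ξ-succ r) = ξ-succ (⟶ᵗ⇒⟶₁ r)
  ⟶ᵗ⇒⟶₁ (ξ-app r)  = ξ-app (⟶ᵗ⇒⟶₁ r)
  ⟶ᵗ⇒⟶₁ (ξ-if r)   = ξ-if (⟶ᵗ⇒⟶₁ r)

  ⟶ᵗ-unique : ∀ {M N₀ N₁ N′ : Term n} {κ κ′} → M ⟶ᵗ⟨ κ ⟩ N₀ ∣ N₁ → M ⟶⟨ κ′ ⟩ N′ →
              (κ′ ≡ κ × N′ ≡ N₀) ⊎ (κ′ ≡ 1- κ × N′ ≡ N₁)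
  ⟶ᵗ-unique coin        coin₀       = inj₁ (refl , refl)
  ⟶ᵗ-unique coin        coin₁       = inj₂ (refl , refl)
  ⟶ᵗ-unique (ξ-succ r)  (ξ-succ r′) =
    Sum.map (map₂ (cong succ)) (map₂ (cong succ)) (⟶ᵗ-unique r r′)
  ⟶ᵗ-unique (ξ-app r)   (ξ-app r′)  =
    Sum.map (map₂ (cong (_· _))) (map₂ (cong (_· _))) (⟶ᵗ-unique r r′)
  ⟶ᵗ-unique (ξ-if r)    (ξ-if r′)   =
    Sum.map (map₂ (cong λ N → if N _ _)) (map₂ (cong λ N → if N _ _)) (⟶ᵗ-unique r r′)
  ⟶ᵗ-unique (ξ-succ ()) succ-β
  ⟶ᵗ-unique (ξ-app ())  lam-β
  ⟶ᵗ-unique (ξ-if ())   if-zero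
  ⟶ᵗ-unique (ξ-if ())   if-suc

  ⟶ᵗ-distinct : ∀ {M N₀ N₁ : Term n} {κ} → M ⟶ᵗ⟨ κ ⟩ N₀ ∣ N₁ → N₀ ≢ N₁
  ⟶ᵗ-distinct (ξ-succ r) refl = ⟶ᵗ-distinct r refl
  ⟶ᵗ-distinct (ξ-app r)  refl = ⟶ᵗ-distinct r refl
  ⟶ᵗ-distinct (ξ-if r)   refl = ⟶ᵗ-distinct r refl

  ≼-Prob : ∀ {M M′ : Term n} {κ} → M ⟶⟨ κ ⟩ M′ → (∀ {κ′} → M ⟶⟨ κ′ ⟩ M′ → κ′ ≡ κ) →
           ι κ ≼ ι (Prob M M′)
  ≼-Prob {M} {M′} r unique with step? M M′
  ... | yes (_ , r′) with unique r′
  ... | refl = ≼-refl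
  ≼-Prob {M} {M′} r unique | no ¬r = contradiction (_ , r) ¬r

  Probs-⟶ᵈ : ∀ {M N : Term n} → M ⟶ᵈ N → ∀ M′ → ι (Prob M M′) ≼ e _≟_ N M′
  Probs-⟶ᵈ {M} {N} r M′ = Prob-≼ M M′ hit λ v _ → contradiction (_ , _ , ⟶ᵈ⇒⟶ r) v
    where
    hit : ∀ {κ} → M ⟶⟨ κ ⟩ M′ → ι κ ≼ e _≟_ N M′
    hit r′ with ⟶ᵈ-unique r r′
    ... | refl , refl = ≼-trans (mk≼ λ h → h) (e-diag _≟_ N)

  Probs-⟶ᵗ : ∀ {M N₀ N₁ : Term n} {κ} → M ⟶ᵗ⟨ κ ⟩ N₀ ∣ N₁ → ∀ M′ →
             ι (Prob M M′) ≼ pick _≟_ (ι κ) N₀ M′ ⊕ pick _≟_ (ι (1- κ)) N₁ M′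
  Probs-⟶ᵗ {M} {N₀} {N₁} {κ} r M′ = Prob-≼ M M′ hit λ v _ → contradiction (_ , _ , ⟶ᵗ⇒⟶₀ r) v
    where
    hit : ∀ {κ′} → M ⟶⟨ κ′ ⟩ M′ → ι κ′ ≼ pick _≟_ (ι κ) N₀ M′ ⊕ pick _≟_ (ι (1- κ)) N₁ M′
    hit r′ with ⟶ᵗ-unique r r′
    ... | inj₁ (refl , refl) = ≼-trans (pick-diag _≟_ (ι κ) N₀) x≼x⊕y
    ... | inj₂ (refl , refl) = ≼-trans (pick-diag _≟_ (ι (1- κ)) N₁) x≼y⊕x

-- Invariance of the semantics

lfp-unfold : ∀ t (f : El (t ⇒ t)) →
             t ∋ Fixpoint.lfp ⟦ t ⟧ᵗ f ≈ app f (Fixpoint.lfp ⟦ t ⟧ᵗ f)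
lfp-unfold t f =
  T.⨆-least (chain f) (λ { zero → T.⊥-least ; (suc k) → mono f (T.⨆-upper (chain f) k) }) ,
  T.⊑-trans (cont f (iterate f) (chain f)) (T.⨆-least _ λ k → T.⨆-upper (chain f) (suc k))
  where
  module T = Domain ⟦ t ⟧ᵗ
  open Fixpoint ⟦ t ⟧ᵗ

⟦if-lit⟧ : ∀ {n} {Γ : Vec Ty n} {t P Q} k (p : Γ ⊢ P ∶ t) (q : nat ∷ Γ ⊢ Q ∶ t) (γ : Env Γ) →
           t ∋ app ⟦ if (lit {k = k}) p q ⟧ γ ≈ branches p q γ k
⟦if-lit⟧ {t = t} k p q γ =
  wsum-point t ℕ._≟_ (point k) (λ _ → ≼-refl) (e-diag ℕ._≟_ k) (branches p q γ)

shift-e : ∀ k n → shift (e ℕ._≟_ k) n ≋ e ℕ._≟_ (suc k) n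
shift-e k zero = ≋-refl
shift-e k (suc n) with k ℕ.≟ n | suc k ℕ.≟ suc n
... | yes _    | yes _   = ≋-refl
... | no _     | no _    = ≋-refl
... | yes refl | no k≢k  = contradiction refl k≢k
... | no k≢n   | yes k≡n = contradiction (ℕ.suc-injective k≡n) k≢n

⟦⟶ᵈ⟧ : ∀ {n} {Γ : Vec Ty n} {M N t} (r : M ⟶ᵈ N) (d : Γ ⊢ M ∶ t) (γ : Env Γ) →
       t ∋ app ⟦ d ⟧ γ ≈ app ⟦ preservation (⟶ᵈ⇒⟶ r) d ⟧ γ
⟦⟶ᵈ⟧ {t = t} fix (fix d) γ = lfp-unfold t (app ⟦ d ⟧ γ)
⟦⟶ᵈ⟧ (succ-β {k}) (succ lit) γ =
  mk≤ᵖ (λ n → proj₁ (shift-e k n)) , mk≤ᵖ (λ n → proj₂ (shift-e k n))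
⟦⟶ᵈ⟧ lam-β (lam d · c) γ = ⟦single⟧ d c γ
⟦⟶ᵈ⟧ if-zero (if lit p q) γ = ⟦if-lit⟧ 0 p q γ
⟦⟶ᵈ⟧ {t = t} (if-suc {k}) (if lit p q) γ =
  ≈-trans t (⟦if-lit⟧ (suc k) p q γ) (⟦single⟧ q (lit {k = k}) γ)
⟦⟶ᵈ⟧ (ξ-succ r) (succ d) γ = succ-cong (⟦⟶ᵈ⟧ r d γ)
⟦⟶ᵈ⟧ (ξ-app r) (_·_ {t} {u} d c) γ =
  app-cong₂ t u {app ⟦ d ⟧ γ} {app ⟦ preservation (⟶ᵈ⇒⟶ r) d ⟧ γ} (⟦⟶ᵈ⟧ r d γ) (≈-refl t)
⟦⟶ᵈ⟧ {t = t} (ξ-if r) (if d p q) γ =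
  wsum-cong t ℕ._≟_ {x = branches p q γ} (⟦⟶ᵈ⟧ r d γ) λ k → ≈-refl t

⟦⟶ᵗ⟧ : ∀ {n} {Γ : Vec Ty n} {M N₀ N₁ κ t} (r : M ⟶ᵗ⟨ κ ⟩ N₀ ∣ N₁) (d : Γ ⊢ M ∶ t) (γ : Env Γ) →
       Combination t (ι κ) (ι (1- κ)) (app ⟦ preservation (⟶ᵗ⇒⟶₀ r) d ⟧ γ)
         (app ⟦ preservation (⟶ᵗ⇒⟶₁ r) d ⟧ γ) (app ⟦ d ⟧ γ)
⟦⟶ᵗ⟧ coin coin γ = lift λ n → ≋-refl
⟦⟶ᵗ⟧ (ξ-succ r) (succ d) γ = succ-linear
  {v = app ⟦ preservation (⟶ᵗ⇒⟶₀ r) d ⟧ γ} {app ⟦ preservation (⟶ᵗ⇒⟶₁ r) d ⟧ γ} {app ⟦ d ⟧ γ}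
  (⟦⟶ᵗ⟧ r d γ)
⟦⟶ᵗ⟧ (ξ-app r) (d · c) γ = ⟦⟶ᵗ⟧ r d γ (app ⟦ c ⟧ γ)
⟦⟶ᵗ⟧ {t = t} (ξ-if r) (if d p q) γ = wsum-linear t (⟦⟶ᵗ⟧ r d γ) (branches p q γ)

⟦⟧₀-typed : ∀ {n} {Γ : Vec Ty n} {M t} (d : Γ ⊢ M ∶ t) → ⟦ Γ ⊢ M ∶ t ⟧₀ ≡ ⟦ d ⟧
⟦⟧₀-typed {Γ = Γ} {M} {t} d with check Γ M t
... | yes d′ = cong ⟦_⟧ (⊢-irrelevant d′ d)
... | no ¬d  = contradiction d ¬d

proposition3p4 : {n : ℕ} (Γ : Vec Ty n) (M : Term n) (t : Ty) (d : Γ ⊢ M ∶ t) →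
    ¬ Value M →
    let open Domain (⟦ Γ ⟧ᶜ ⇒ᴰ ⟦ t ⟧ᵗ) in
    ⟦ d ⟧ ≈ wsum _≟_ (Probs M) (λ M′ → ⟦ Γ ⊢ M′ ∶ t ⟧₀)
proposition3p4 Γ M t d ¬v = (λ γ → proj₁ (main γ)) , (λ γ → proj₂ (main γ))
  where
  value₀ : Env Γ → Term _ → El t
  value₀ γ M′ = app ⟦ Γ ⊢ M′ ∶ t ⟧₀ γ
  reduct : ∃[ κ ] ∃[ N ] M ⟶⟨ κ ⟩ N
  reduct with outcome M
  ... | value v    = contradiction v ¬v
  ... | step r _   = _ , _ , r
  ... | toss r _ _ = _ , _ , r
  main : ∀ γ → t ∋ app ⟦ d ⟧ γ ≈ Domain.wsum ⟦ t ⟧ᵗ _≟_ (Probs M) (value₀ γ)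
  main γ with classify (proj₂ (proj₂ reduct))
  ... | inj₁ (N , r) = ≈-trans t
    (subst (λ f → t ∋ app ⟦ d ⟧ γ ≈ app f γ) (sym (⟦⟧₀-typed (preservation (⟶ᵈ⇒⟶ r) d)))
      (⟦⟶ᵈ⟧ r d γ))
    (≈-sym t (wsum-point t _≟_ (Probs M) (Probs-⟶ᵈ r)
      (≼-trans (mk≼ λ h → h)
        (≼-Prob (⟶ᵈ⇒⟶ r) λ r′ → proj₁ (⟶ᵈ-unique r r′)))
      (value₀ γ)))
  ... | inj₂ (κ , N₀ , N₁ , r) =
    wsum-two-points t _≟_ (Probs M) N₀≢N₁
      (≼-Prob (⟶ᵗ⇒⟶₀ r) λ r′ →
        Sum.[ proj₁ , (λ (_ , eq) → contradiction eq N₀≢N₁) ] (⟶ᵗ-unique r r′))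
      (≼-Prob (⟶ᵗ⇒⟶₁ r) λ r′ →
        Sum.[ (λ (_ , eq) → contradiction (sym eq) N₀≢N₁) , proj₁ ] (⟶ᵗ-unique r r′))
      (Probs-⟶ᵗ r) (value₀ γ)
      (subst₂ (λ f g → Combination t (ι κ) (ι (1- κ)) (app f γ) (app g γ) (app ⟦ d ⟧ γ))
        (sym (⟦⟧₀-typed (preservation (⟶ᵗ⇒⟶₀ r) d)))
        (sym (⟦⟧₀-typed (preservation (⟶ᵗ⇒⟶₁ r) d)))
        (⟦⟶ᵗ⟧ r d γ))
    where
    N₀≢N₁ : N₀ ≢ N₁
    N₀≢N₁ = ⟶ᵗ-distinct r
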